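{- Let $B(u)$ be the generating matrix of the reflection algebra $\mathcal B(n,l)$. For any $\sigma\in S_n$ consider the decomposition $\sigma=\Gamma_1\cdots\Gamma_s$ into nonintersecting cycles (fixed points counted as cycles of length one), let $g_i$ be the maximal element of the cycle $\Gamma_i$, and let $G_\sigma=\{g_i\}_{i=1}^s$. Then $$\langle\langle B_1,\dots,B_n\rangle\rangle=\sum_{\sigma\in S_n}\bar\alpha(\sigma)\,\sigma^{ -1}\,B_{\sigma^{[1]}(1)}(u)\,B_{\sigma^{[2]}(2)}(u-1)\cdots B_{\sigma^{[n]}(n)}(u-n+1),$$ where $$\bar\alpha(\sigma)=\prod_{g\in\{1,\dots,n\}\setminus G_\sigma}\frac{1}{n-2u-2+g},$$ the permutation $\sigma^{[i]}$ is the word restriction of $\sigma$ on the set $\{i,\dots,n\}$, and $\sigma^{ -1}$ is identified with the corresponding operator acting on $(\mathbb C^n)^{\otimes n}$.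
   Context: Reflection algebra. Let $n=m+l$ with $m,l$ nonnegative integers, and $\varepsilon_i=1$ for $1\le i\le m$, $\varepsilon_i=-1$ for $m<i\le n$. Let $P:v\otimes w\mapsto w\otimes v$ on $\mathbb C^n\otimes\mathbb C^n$ and $R(u)=1-P/u$. The reflection algebra $\mathcal B(n,l)$ is the unital associative algebra over $\mathbb C$ with generators $b_{ij}^{(r)}$ ($i,j=1,\dots,n$, $r=0,1,2,\dots$), $b_{ij}^{(0)}=\delta_{ij}\varepsilon_i$, collected into series $b_i^j(u)=\sum_{r\ge0}b_{ij}^{(r)}u^{ -r}$ and the matrix $B(u)=\sum_{i,j}E_{ij}\otimes b_i^j(u)\in\operatorname{End}\mathbb C^n\otimes\mathcal B(n,l)[[u^{ -1}]]$, subject to the reflection equation $R(u-v)B_1(u)R(u+v)B_2(v)=B_2(v)R(u+v)B_1(u)R(u-v)$ and the unitary condition $B(u)B(-u)=1$. For a matrix $X=(x_{ij})$ over an associative algebra $A$, $X_s=\sum_{i,j}1\otimes\cdots\otimes E_{ij}\otimes\cdots\otimes1\otimes x_{ij}\in\operatorname{End}(\mathbb C^n)^{\otimes n}\otimes A$ with $E_{ij}$ in the $s$-th position; $P_{ij}$ denotes $P$ acting on the $i$-th and $j$-th copies of $\mathbb C^n$ in $(\mathbb C^n)^{\otimes n}$. The symmetric group $S_n$ acts on $(\mathbb C^n)^{\otimes n}$ by permuting tensor factors, the transposition $(i,j)$ acting as $P_{ij}$ (a product of transpositions acts as the product of the corresponding operators in the same order). Products of permutations are composed from right to left, and the cycle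 $(a_1,\dots,a_r)$ sends $a_1\mapsto a_2\mapsto\cdots\mapsto a_r\mapsto a_1$. Shifted series and rational functions of $u$ are expanded as power series in $u^{ -1}$. For $k=1,\dots,n$ put $\Pi_k=1-(2u-k-n+2)^{ -1}\sum_{i=k+1}^nP_{ki}$, and $$\langle\langle B_1,\dots,B_n\rangle\rangle=B_1(u)\Pi_1B_2(u-1)\Pi_2\cdots B_{n-1}(u-n+2)\Pi_{n-1}B_n(u-n+1).$$ Word restriction. Let $\sigma=\Gamma_1\cdots\Gamma_s$ be the decomposition of a permutation of $\{1,\dots,n\}$ into nonintersecting cycles and $G\subset\{1,\dots,n\}$. The word restriction $\Gamma|_G$ of a cycle $\Gamma$ is obtained by deleting from the word of the cycle all elements not belonging to $G$ (it is empty if $\Gamma$ contains no elements of $G$). The word restriction of $\sigma$ on $G$ is $\sigma|_G=\Gamma_1|_G\cdots\Gamma_s|_G$. For example, the word restriction of $(1,5,7,3)(4)(6,2)$ on $\{1,2,3\}$ is $(1,3)(2)$. -}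

module Defs where

open import Algebra.Apartness.Bundles using (HeytingCommutativeRing; HeytingField)
open import Algebra.Bundles using (CommutativeRing; RawRing; Ring)
import Algebra.Definitions as Definitions
import Algebra.Definitions.RawSemiring as RawSemiringDefinitions
import Algebra.Properties.Ring as RingProperties
open import Data.Bool.Base using (true; false; if_then_else_)
open import Data.Fin.Base using (Fin; zero; suc; toℕ; finToFun; funToFin; splitAt)
import Data.Fin.Base as Fin
open import Data.Fin.Permutation
  using (Permutation′; _⟨$⟩ʳ_; _⟨$⟩ˡ_; _∘ₚ_; transpose; lift₀; remove;
         lift₀-remove; lift₀-cong; inverseʳ)
import Data.Fin.Permutation as Perm
open import Data.Fin.Properties using (_≟_)
import Data.Fin.Properties as Fin
open import Data.Integer.Base using (ℤ; +_; -[1+_])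
import Data.Integer.Base as ℤ
open import Data.List.Base
  using (List; []; _∷_; map; foldr; filter; concat; length; allFin; cartesianProductWith)
import Data.List.Membership.DecPropositional as DecMembership
open import Data.List.Membership.Propositional using (_∈_; _∉_)
open import Data.List.Membership.Propositional.Properties
  using (∈-map⁺; ∈-map⁻; ∈-allFin; ∈-++⁺ˡ; ∈-++⁺ʳ; ∈-++⁻)
open import Data.List.Properties
  using (concat-map; length-tabulate; map-tabulate; length-++; length-map)
open import Data.List.Relation.Binary.Permutation.Propositional
  using (_↭_; ↭-refl; ↭-sym; ↭-trans; ↭-prep; ↭-swap; ↭-reflexive)
open import Data.List.Relation.Binary.Permutation.Propositional.Properties
  using (∈-resp-↭; map⁺; shift; ++⁺ˡ; ++⁺ʳ)
open import Data.List.Relation.Unary.All using (All; []; _∷_)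
import Data.List.Relation.Unary.All as All
import Data.List.Relation.Unary.All.Properties as All
open import Data.List.Relation.Unary.Any using (Any; here; there)
import Data.List.Relation.Unary.Any as Any
open import Data.List.Relation.Unary.Any.Properties using (cartesianProductWith⁺)
open import Data.Nat.Base using (ℕ; zero; suc; _∸_; _^_; _!)
import Data.Nat.Base as ℕ
open import Data.Nat.Properties using (*-comm)
open import Data.Product.Base using (Σ; _×_; _,_; proj₁; proj₂)
open import Data.Sum.Base using (_⊎_; inj₁; inj₂; [_,_]′)
open import Function.Base using (_∘_; id; const)
open import Level using (Level; _⊔_)
open import Relation.Binary.PropositionalEquality
  using (_≡_; _≢_; refl; sym; trans; cong; cong₂; subst; module ≡-Reasoning)
open import Relation.Nullary using (Dec; does; yes; no; ¬?; contradiction)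
open import Relation.Nullary.Decidable using (_×-dec_; dec-true; dec-false)

private variable
  c ℓ ℓ₁ ℓ₂ : Level
  n p : ℕ

-- f represents Σ_r f(r) u⁻ʳ.
Series : RawRing c ℓ → RawRing c ℓ
Series R = record
  { Carrier = ℕ → Carrier
  ; _≈_     = λ f g → ∀ r → f r ≈ g r
  ; _+_     = λ f g r → f r + g r
  ; _*_     = λ f g r → sum {suc r} λ i → f (toℕ i) * g (r ∸ toℕ i)
  ; -_      = λ f r → - f r
  ; 0#      = λ _ → 0#
  ; 1#      = λ { zero → 1# ; (suc _) → 0# }
  }
  where
  open RawRing R
  open RawSemiringDefinitions rawSemiring using (sum)

module _ (R : RawRing c ℓ) where
  open RawRing R
  open RawSemiringDefinitions rawSemiring using () renaming (_^_ to _^ᴿ_)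

  constant : Carrier → ℕ → Carrier
  constant x zero    = x
  constant x (suc _) = 0#

  -- (u - x)⁻¹ = Σ_r xʳ u⁻ʳ⁻¹
  [u-_]⁻¹ : Carrier → ℕ → Carrier
  [u- x ]⁻¹ zero    = 0#
  [u- x ]⁻¹ (suc r) = x ^ᴿ r

  -- (N , f) represents vᴺ Σ_r f(r) v⁻ʳ.
  LaurentCarrier : Set c
  LaurentCarrier = ℕ × (ℕ → Carrier)

  delay : ℕ → (ℕ → Carrier) → ℕ → Carrier
  delay zero    f r       = f r
  delay (suc N) f zero    = 0#
  delay (suc N) f (suc r) = delay N f r

  coefficient : LaurentCarrier → ℤ → Carrier
  coefficient (N , f) z with (+ N) ℤ.- z
  ... | + r      = f r
  ... | -[1+ _ ] = 0#

  Laurent : RawRing c ℓ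
  Laurent = record
    { Carrier = LaurentCarrier
    ; _≈_     = λ x y → ∀ z → coefficient x z ≈ coefficient y z
    ; _+_     = λ { (M , f) (N , g) → M ℕ.+ N , λ r → delay N f r + delay M g r }
    ; _*_     = λ { (M , f) (N , g) → M ℕ.+ N , S._*_ f g }
    ; -_      = λ { (N , f) → N , S.-_ f }
    ; 0#      = 0 , S.0#
    ; 1#      = 0 , S.1#
    }
    where module S = RawRing (Series R)

module Tensor (R : RawRing c ℓ) where
  open RawRing R
  open RawSemiringDefinitions rawSemiring using (sum; product)

  Matrix : ℕ → RawRing c ℓ
  Matrix N = record
    { Carrier = Fin N → Fin N → Carrier
    ; _≈_     = λ X Y → ∀ i j → X i j ≈ Y i j
    ; _+_     = λ X Y i j → X i j + Y i j
    ; _*_     = λ X Y i j → sum λ k → X i k * Y k j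
    ; -_      = λ X i j → - X i j
    ; 0#      = λ _ _ → 0#
    ; 1#      = λ i j → if does (i ≟ j) then 1# else 0#
    }

  Mat : ℕ → Set c
  Mat N = RawRing.Carrier (Matrix N)

  infixr 8 _∙_
  _∙_ : ∀ {N} → Carrier → Mat N → Mat N
  (x ∙ X) i j = x * X i j

  E : Fin n → Fin n → Mat n
  E a b i j = if does (a ≟ i) then (if does (b ≟ j) then 1# else 0#) else 0#

  -- The basis of (Rⁿ)^⊗p is Fin (n ^ p): the index I stands for
  -- e_{I₁} ⊗ … ⊗ e_{Iₚ} with I_t = finToFun I t.
  ⨂ : (Fin p → Mat n) → Mat (n ^ p)
  ⨂ X I J = product λ t → X t (finToFun I t) (finToFun J t)

  -- 1 ⊗ … ⊗ E_ij ⊗ … ⊗ 1 ⊗ x_ij summed over i , j, with E_ij in position s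
  slot : Fin p → Mat n → Mat (n ^ p)
  slot {n = n} s X I J = sum λ i → sum λ j →
    ⨂ (λ t → if does (t ≟ s) then E i j else RawRing.1# (Matrix n)) I J * X i j

  -- The factor in position s moves to position π(s):
  -- e_{J₁} ⊗ … ⊗ e_{Jₚ} ↦ e_{J_{π⁻¹(1)}} ⊗ … ⊗ e_{J_{π⁻¹(p)}}.
  operator : Permutation′ p → Mat (n ^ p)
  operator π I J =
    if does (I ≟ funToFin (λ t → finToFun J (π ⟨$⟩ˡ t))) then 1# else 0#

  P : Fin p → Fin p → Mat (n ^ p)
  P i j = operator (transpose i j)

commutativeRing : HeytingField c ℓ₁ ℓ₂ → CommutativeRing c ℓ₁
commutativeRing K =
  HeytingCommutativeRing.commutativeRing (HeytingField.heytingCommutativeRing K)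

rawRing : HeytingField c ℓ₁ ℓ₂ → RawRing c ℓ₁
rawRing K = CommutativeRing.rawRing (commutativeRing K)

data Term {k} (K : Set k) (X : Set) : Set k where
  generator : X → Term K X
  scalar    : K → Term K X
  add mul   : Term K X → Term K X → Term K X
  neg       : Term K X → Term K X

rawTerms : RawRing c ℓ → Set → RawRing c c
rawTerms K X = record
  { Carrier = Term (RawRing.Carrier K) X
  ; _≈_     = _≡_
  ; _+_     = add
  ; _*_     = mul
  ; -_      = neg
  ; 0#      = scalar (RawRing.0# K)
  ; 1#      = scalar (RawRing.1# K)
  }

-- The unital associative K-algebra on generators X subject to x = y for
-- every pair x , y with Rel x y.
module Presented (K : RawRing c ℓ) (X : Set)
                 (Rel : Term (RawRing.Carrier K) X → Term (RawRing.Carrier K) X → Set c) where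
  private module K = RawRing K
  open RawRing (rawTerms K X) hiding (_≈_)

  infix 4 _≈_
  data _≈_ : Carrier → Carrier → Set (c ⊔ ℓ) where
    relation        : ∀ {x y} → Rel x y → x ≈ y
    ≈-refl          : ∀ {x} → x ≈ x
    ≈-sym           : ∀ {x y} → x ≈ y → y ≈ x
    ≈-trans         : ∀ {x y z} → x ≈ y → y ≈ z → x ≈ z
    +-cong          : ∀ {x y z w} → x ≈ y → z ≈ w → x + z ≈ y + w
    *-cong          : ∀ {x y z w} → x ≈ y → z ≈ w → x * z ≈ y * w
    neg-cong        : ∀ {x y} → x ≈ y → - x ≈ - y
    +-assoc         : ∀ x y z → (x + y) + z ≈ x + (y + z)
    +-comm          : ∀ x y → x + y ≈ y + x
    +-identity      : ∀ x → 0# + x ≈ x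
    +-inverse       : ∀ x → - x + x ≈ 0#
    *-assoc         : ∀ x y z → (x * y) * z ≈ x * (y * z)
    *-identityˡ     : ∀ x → 1# * x ≈ x
    *-identityʳ     : ∀ x → x * 1# ≈ x
    distribˡ        : ∀ x y z → x * (y + z) ≈ x * y + x * z
    distribʳ        : ∀ x y z → (y + z) * x ≈ y * x + z * x
    scalar-cong     : ∀ {a b} → a K.≈ b → scalar a ≈ scalar b
    scalar-+        : ∀ a b → scalar (a K.+ b) ≈ scalar a + scalar b
    scalar-*        : ∀ a b → scalar (a K.* b) ≈ scalar a * scalar b
    scalar-central  : ∀ a x → scalar a * x ≈ x * scalar a

  ring : Ring c (c ⊔ ℓ)
  ring = record
    { Carrier = Carrier
    ; _≈_ = _≈_
    ; _+_ = _+_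
    ; _*_ = _*_
    ; -_  = -_
    ; 0#  = 0#
    ; 1#  = 1#
    ; isRing = record
      { +-isAbelianGroup = record
        { isGroup = record
          { isMonoid = record
            { isSemigroup = record
              { isMagma = record
                { isEquivalence = record { refl = ≈-refl ; sym = ≈-sym ; trans = ≈-trans }
                ; ∙-cong = +-cong
                }
              ; assoc = +-assoc
              }
            ; identity = +-identity , λ x → ≈-trans (+-comm x 0#) (+-identity x)
            }
          ; inverse = +-inverse , λ x → ≈-trans (+-comm x (- x)) (+-inverse x)
          ; ⁻¹-cong = neg-cong
          }
        ; comm = +-comm
        }
      ; *-cong = *-cong
      ; *-assoc = *-assoc
      ; *-identity = *-identityˡ , *-identityʳ
      ; distrib = distribˡ , distribʳ
      }
    }

open module DecidableMembership {n} = DecMembership (_≟_ {n}) using (_∈?_)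

-- Every permutation of {0,…,n} is uniquely τ ∘ (0 i) with τ fixing 0.
permutations : ∀ n → List (Permutation′ n)
permutations zero    = Perm.id ∷ []
permutations (suc n) =
  cartesianProductWith (λ τ i → transpose zero i ∘ₚ lift₀ τ) (permutations n) (allFin (suc n))

-- The cycle written as the word a₁ … aᵣ: a₁ ↦ a₂ ↦ … ↦ aᵣ ↦ a₁.
cycle : List (Fin n) → Fin n → Fin n
cycle []      i = i
cycle (a ∷ w) i = go a w
  module Cycle where
  go : Fin _ → List (Fin _) → Fin _
  go x []      = if does (i ≟ x) then a else i
  go x (y ∷ w) = if does (i ≟ x) then y else go y w

⟦_⟧ : List (List (Fin n)) → Fin n → Fin n
⟦ ws ⟧ = foldr (λ w f → cycle w ∘ f) id ws

-- A decomposition into nonintersecting cycles, fixed points included.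
-- It is unique only up to the order of the cycles and the starting point
-- of each word.
record CycleDecomposition (σ : Permutation′ n) : Set where
  field
    words    : List (List (Fin n))
    nonEmpty : All (_≢ []) words
    disjoint : concat words ↭ allFin n
    correct  : ∀ i → ⟦ words ⟧ i ≡ σ ⟨$⟩ʳ i

  -- The word restriction of σ on {i , i + 1 , …}.
  restrict≥ : Fin n → Fin n → Fin n
  restrict≥ i = ⟦ map (filter (i Fin.≤?_)) words ⟧

  -- g ∈ G_σ: g is the maximal element of one of the cycles.
  IsCycleMaximum : Fin n → Set
  IsCycleMaximum g = Any (λ w → g ∈ w × All (Fin._≤ g) w) words

  isCycleMaximum? : ∀ g → Dec (IsCycleMaximum g)
  isCycleMaximum? g = Any.any? (λ w → (g ∈? w) ×-dec All.all? (Fin._≤? g) w) words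

  nonMaxima : List (Fin n)
  nonMaxima = filter (¬? ∘ isCycleMaximum?) (allFin n)

private
  transpose-≡ˡ : (i j : Fin n) → transpose i j ⟨$⟩ʳ i ≡ j
  transpose-≡ˡ i j rewrite dec-true (i ≟ i) refl = refl

  transpose-≡ʳ : (i j : Fin n) → transpose i j ⟨$⟩ʳ j ≡ i
  transpose-≡ʳ i j with j ≟ i
  ... | yes j≡i = j≡i
  ... | no  _ rewrite dec-true (j ≟ j) refl = refl

  transpose-≢ : ∀ {i j k : Fin n} → k ≢ i → k ≢ j → transpose i j ⟨$⟩ʳ k ≡ k
  transpose-≢ {i = i} {j} {k} k≢i k≢j
    rewrite dec-false (k ≟ i) k≢i | dec-false (k ≟ j) k≢j = refl

  transpose-transpose : (i j k : Fin n) → transpose i j ⟨$⟩ʳ (transpose i j ⟨$⟩ʳ k) ≡ k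
  transpose-transpose i j k with k ≟ i
  ... | yes refl = transpose-≡ʳ i j
  ... | no  k≢i with k ≟ j
  ...   | yes refl = transpose-≡ˡ i j
  ...   | no  k≢j = transpose-≢ k≢i k≢j

  -- σ = τ ∘ (0 i), where i = σ⁻¹(0)
  module Peel (σ : Permutation′ (suc n)) where
    i : Fin (suc n)
    i = σ ⟨$⟩ˡ zero

    fixing-zero : Permutation′ (suc n)
    fixing-zero = transpose zero i ∘ₚ σ

    τ : Permutation′ n
    τ = remove zero fixing-zero

    peel : ∀ j → lift₀ τ ⟨$⟩ʳ (transpose zero i ⟨$⟩ʳ j) ≡ σ ⟨$⟩ʳ j
    peel j = trans
      (lift₀-remove fixing-zero
        (trans (cong (σ ⟨$⟩ʳ_) (transpose-≡ˡ zero i)) (inverseʳ σ)) (transpose zero i ⟨$⟩ʳ j))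
      (cong (σ ⟨$⟩ʳ_) (transpose-transpose zero i j))

private
  length-cartesianProductWith : ∀ {A B C : Set} (f : A → B → C) xs ys →
    length (cartesianProductWith f xs ys) ≡ length xs ℕ.* length ys
  length-cartesianProductWith f []       ys = refl
  length-cartesianProductWith f (x ∷ xs) ys = trans (length-++ (map (f x) ys))
    (cong₂ ℕ._+_ (length-map (f x) ys) (length-cartesianProductWith f xs ys))

length-permutations : ∀ n → length (permutations n) ≡ n !
length-permutations zero    = refl
length-permutations (suc n) = begin
  length (permutations (suc n))
    ≡⟨ length-cartesianProductWith _ (permutations n) (allFin (suc n)) ⟩
  length (permutations n) ℕ.* length (allFin (suc n))
    ≡⟨ cong₂ ℕ._*_ (length-permutations n) (length-tabulate {n = suc n} id) ⟩
  n ! ℕ.* suc n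
    ≡⟨ *-comm (n !) (suc n) ⟩
  suc n !
    ∎
  where open ≡-Reasoning

permutations-complete : (σ : Permutation′ n) → Any (Perm._≈ σ) (permutations n)
permutations-complete {zero}  σ = here λ ()
permutations-complete {suc n} σ =
  cartesianProductWith⁺ _
    (λ {π} {j} π≈τ i≡j k → trans
      (cong (λ j → lift₀ π ⟨$⟩ʳ (transpose zero j ⟨$⟩ʳ k)) (sym i≡j))
      (trans (lift₀-cong π τ π≈τ (transpose zero i ⟨$⟩ʳ k)) (peel k)))
    (permutations-complete τ)
    (∈-allFin i)
  where open Peel σ

private
  cycle-support : (w : List (Fin n)) (i : Fin n) → cycle w i ≡ i ⊎ cycle w i ∈ w
  cycle-support []      i = inj₁ refl
  cycle-support (a ∷ w) i = go-support a w (here refl) there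
    where
    open Cycle a w i
    go-support : ∀ x v → a ∈ a ∷ w → (∀ {j} → j ∈ v → j ∈ a ∷ w) →
                 go x v ≡ i ⊎ go x v ∈ a ∷ w
    go-support x []      a∈ v⊆ with i ≟ x
    ... | yes _ = inj₂ a∈
    ... | no  _ = inj₁ refl
    go-support x (y ∷ v) a∈ v⊆ with i ≟ x
    ... | yes _ = inj₂ (v⊆ (here refl))
    ... | no  _ = go-support y v a∈ (v⊆ ∘ there)

  cycle-∉ : (w : List (Fin n)) {i : Fin n} → i ∉ w → cycle w i ≡ i
  cycle-∉ []      i∉w = refl
  cycle-∉ (a ∷ w) {i} i∉w = go-∉ a w i∉w
    where
    open Cycle a w i
    go-∉ : ∀ x v → i ∉ x ∷ v → go x v ≡ i
    go-∉ x []      i∉ rewrite dec-false (i ≟ x) (i∉ ∘ here) = refl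
    go-∉ x (y ∷ v) i∉ rewrite dec-false (i ≟ x) (i∉ ∘ here) = go-∉ y v (i∉ ∘ there)

  cycle-suc : (w : List (Fin n)) (i : Fin n) → cycle (map suc w) (suc i) ≡ suc (cycle w i)
  cycle-suc []      i = refl
  cycle-suc (a ∷ w) i = go-suc a w
    where
    go-suc : ∀ x v → Cycle.go (suc a) (map suc w) (suc i) (suc x) (map suc v) ≡
                     suc (Cycle.go a w i x v)
    go-suc x []      with does (i ≟ x)
    ... | true  = refl
    ... | false = refl
    go-suc x (y ∷ v) with does (i ≟ x)
    ... | true  = refl
    ... | false = go-suc y v

  ⟦⟧-support : (ws : List (List (Fin n))) (i : Fin n) → ⟦ ws ⟧ i ≡ i ⊎ ⟦ ws ⟧ i ∈ concat ws
  ⟦⟧-support []       i = inj₁ refl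
  ⟦⟧-support (w ∷ ws) i with cycle-support w (⟦ ws ⟧ i) | ⟦⟧-support ws i
  ... | inj₂ c∈w | _          = inj₂ (∈-++⁺ˡ c∈w)
  ... | inj₁ c≡  | inj₁ ≡i    = inj₁ (trans c≡ ≡i)
  ... | inj₁ c≡  | inj₂ ∈ws   = inj₂ (∈-++⁺ʳ w (subst (_∈ concat ws) (sym c≡) ∈ws))

  ⟦⟧-∉ : (ws : List (List (Fin n))) {i : Fin n} → i ∉ concat ws → ⟦ ws ⟧ i ≡ i
  ⟦⟧-∉ []       i∉ = refl
  ⟦⟧-∉ (w ∷ ws) i∉ =
    trans (cong (cycle w) (⟦⟧-∉ ws (i∉ ∘ ∈-++⁺ʳ w))) (cycle-∉ w (i∉ ∘ ∈-++⁺ˡ))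

  ⟦⟧-suc : (ws : List (List (Fin n))) (i : Fin n) →
           ⟦ map (map suc) ws ⟧ (suc i) ≡ suc (⟦ ws ⟧ i)
  ⟦⟧-suc []       i = refl
  ⟦⟧-suc (w ∷ ws) i =
    trans (cong (cycle (map suc w)) (⟦⟧-suc ws i)) (cycle-suc w (⟦ ws ⟧ i))

  module Insert {n} (x z : Fin n) where
    insertTail : Fin n → List (Fin n) → List (Fin n)
    insertTail y w with y ≟ x
    insertTail y w       | yes _ = z ∷ w
    insertTail y []      | no  _ = []
    insertTail y (u ∷ w) | no  _ = u ∷ insertTail u w

    insert : List (Fin n) → List (Fin n)
    insert []      = []
    insert (y ∷ w) = y ∷ insertTail y w

    insertTail-↭ : ∀ y w → x ∈ y ∷ w → insertTail y w ↭ z ∷ w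
    insertTail-↭ y w       x∈ with y ≟ x
    insertTail-↭ y w       x∈         | yes _   = ↭-refl
    insertTail-↭ y []      (here x≡y) | no  y≢x = contradiction (sym x≡y) y≢x
    insertTail-↭ y (u ∷ w) (here x≡y) | no  y≢x = contradiction (sym x≡y) y≢x
    insertTail-↭ y (u ∷ w) (there x∈) | no  _   =
      ↭-trans (↭-prep u (insertTail-↭ u w x∈)) (↭-swap u z ↭-refl)

    insert-↭ : ∀ w → x ∈ w → insert w ↭ z ∷ w
    insert-↭ (y ∷ w) x∈ = ↭-trans (↭-prep y (insertTail-↭ y w x∈)) (↭-swap y z ↭-refl)

    t : Fin n → Fin n
    t = transpose x z ⟨$⟩ʳ_

    cycle-insert : ∀ w → x ∈ w → z ∉ w → ∀ j → cycle (insert w) j ≡ cycle w (t j)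
    cycle-insert (a ∷ w) x∈w z∉w j with j ≟ x
    ... | yes refl = trans (go-x a w x∈w z∉w) (sym (cycle-∉ (a ∷ w) z∉w))
      where
      go-x : ∀ y v → x ∈ y ∷ v → z ∉ y ∷ v →
             Cycle.go a (insertTail a w) x y (insertTail y v) ≡ z
      go-x y v       x∈ z∉ with y ≟ x
      go-x y v       x∈         z∉ | yes refl rewrite dec-true (x ≟ x) refl = refl
      go-x y []      (here x≡y) z∉ | no  y≢x = contradiction (sym x≡y) y≢x
      go-x y (u ∷ v) (here x≡y) z∉ | no  y≢x = contradiction (sym x≡y) y≢x
      go-x y (u ∷ v) (there x∈) z∉ | no  y≢x
        rewrite dec-false (x ≟ y) (y≢x ∘ sym) = go-x u v x∈ (z∉ ∘ there)
    ... | no j≢x with j ≟ z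
    ...   | yes refl = go-z a w x∈w z∉w
      where
      go-z : ∀ y v → x ∈ y ∷ v → z ∉ y ∷ v →
             Cycle.go a (insertTail a w) z y (insertTail y v) ≡ Cycle.go a w x y v
      go-z y v       x∈ z∉ with y ≟ x
      go-z y []      x∈ z∉ | yes refl
        rewrite dec-false (z ≟ y) (z∉ ∘ here) | dec-true (z ≟ z) refl | dec-true (y ≟ y) refl = refl
      go-z y (u ∷ v) x∈ z∉ | yes refl
        rewrite dec-false (z ≟ y) (z∉ ∘ here) | dec-true (z ≟ z) refl | dec-true (y ≟ y) refl = refl
      go-z y []      (here x≡y) z∉ | no  y≢x = contradiction (sym x≡y) y≢x
      go-z y (u ∷ v) (here x≡y) z∉ | no  y≢x = contradiction (sym x≡y) y≢x
      go-z y (u ∷ v) (there x∈) z∉ | no  y≢x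
        rewrite dec-false (z ≟ y) (z∉ ∘ here) | dec-false (x ≟ y) (y≢x ∘ sym)
        = go-z u v x∈ (z∉ ∘ there)
    ...   | no j≢z = go-j a w
      where
      go-j : ∀ y v → Cycle.go a (insertTail a w) j y (insertTail y v) ≡ Cycle.go a w j y v
      go-j y v with y ≟ x
      go-j y []      | yes refl
        rewrite dec-false (j ≟ y) j≢x | dec-false (j ≟ z) j≢z = refl
      go-j y (u ∷ v) | yes refl
        rewrite dec-false (j ≟ y) j≢x | dec-false (j ≟ z) j≢z = refl
      go-j y []      | no _ = refl
      go-j y (u ∷ v) | no _ with does (j ≟ y)
      ... | true  = refl
      ... | false = go-j u v

    t-⟦⟧ : ∀ ws → x ∉ concat ws → z ∉ concat ws → ∀ j → t (⟦ ws ⟧ j) ≡ ⟦ ws ⟧ (t j)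
    t-⟦⟧ ws x∉ z∉ j with j ≟ x
    ... | yes refl = trans (cong t (⟦⟧-∉ ws x∉)) (trans (transpose-≡ˡ x z) (sym (⟦⟧-∉ ws z∉)))
    ... | no  j≢x with j ≟ z
    ...   | yes refl = trans (cong t (⟦⟧-∉ ws z∉)) (trans (transpose-≡ʳ x z) (sym (⟦⟧-∉ ws x∉)))
    ...   | no  j≢z = transpose-≢ (avoid x∉ j≢x) (avoid z∉ j≢z)
      where
      avoid : ∀ {y} → y ∉ concat ws → j ≢ y → ⟦ ws ⟧ j ≢ y
      avoid y∉ j≢y eq with ⟦⟧-support ws j
      ... | inj₁ ≡j = j≢y (trans (sym ≡j) eq)
      ... | inj₂ ∈ws = y∉ (subst (_∈ concat ws) eq ∈ws)

    insertAll : List (List (Fin n)) → List (List (Fin n))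
    insertAll []       = []
    insertAll (w ∷ ws) with x ∈? concat ws
    ... | yes _ = w ∷ insertAll ws
    ... | no  _ = insert w ∷ ws

    head∈ : ∀ w {ws} → x ∈ concat (w ∷ ws) → x ∉ concat ws → x ∈ w
    head∈ w x∈ x∉ with ∈-++⁻ w x∈
    ... | inj₁ x∈w  = x∈w
    ... | inj₂ x∈ws = contradiction x∈ws x∉

    insertAll-↭ : ∀ ws → x ∈ concat ws → concat (insertAll ws) ↭ z ∷ concat ws
    insertAll-↭ (w ∷ ws) x∈ with x ∈? concat ws
    ... | yes x∈ws = ↭-trans (++⁺ˡ w (insertAll-↭ ws x∈ws)) (shift z w (concat ws))
    ... | no  x∉ws = ++⁺ʳ (concat ws) (insert-↭ w (head∈ w {ws} x∈ x∉ws))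

    insertAll-nonEmpty : ∀ {ws} → All (_≢ []) ws → All (_≢ []) (insertAll ws)
    insertAll-nonEmpty []                      = []
    insertAll-nonEmpty {w ∷ ws} (w≢[] ∷ ws≢[]) with x ∈? concat ws
    ... | yes _ = w≢[] ∷ insertAll-nonEmpty ws≢[]
    ... | no  _ = insert≢[] w w≢[] ∷ ws≢[]
      where
      insert≢[] : ∀ w → w ≢ [] → insert w ≢ []
      insert≢[] []      w≢[] = w≢[]
      insert≢[] (_ ∷ _) _ ()

    ⟦insertAll⟧ : ∀ ws → x ∈ concat ws → z ∉ concat ws →
                  ∀ j → ⟦ insertAll ws ⟧ j ≡ ⟦ ws ⟧ (t j)
    ⟦insertAll⟧ (w ∷ ws) x∈ z∉ j with x ∈? concat ws
    ... | yes x∈ws = cong (cycle w) (⟦insertAll⟧ ws x∈ws (z∉ ∘ ∈-++⁺ʳ w) j)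
    ... | no  x∉ws = trans
      (cycle-insert w (head∈ w {ws} x∈ x∉ws) (z∉ ∘ ∈-++⁺ˡ) (⟦ ws ⟧ j))
      (cong (cycle w) (t-⟦⟧ ws x∉ws (z∉ ∘ ∈-++⁺ʳ w) j))

  cycleDecomposition′ : (τ : Permutation′ n) (σ : Permutation′ (suc n)) (i : Fin (suc n)) →
    (∀ j → lift₀ τ ⟨$⟩ʳ (transpose zero i ⟨$⟩ʳ j) ≡ σ ⟨$⟩ʳ j) →
    CycleDecomposition τ → CycleDecomposition σ
  cycleDecomposition′ {n} τ σ i peel d = by-cases i peel
    where
    module τ = CycleDecomposition d

    ws : List (List (Fin (suc n)))
    ws = map (map suc) τ.words

    concat-ws : concat ws ↭ map suc (allFin n)
    concat-ws = ↭-trans (↭-reflexive (concat-map τ.words)) (map⁺ suc τ.disjoint)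

    zero∉ws : zero ∉ concat ws
    zero∉ws 0∈ with ∈-map⁻ suc (∈-resp-↭ concat-ws 0∈)
    ... | _ , _ , ()

    ws-nonEmpty : All (_≢ []) ws
    ws-nonEmpty = All.map⁺ (All.map map≢[] τ.nonEmpty)
      where
      map≢[] : ∀ {w : List (Fin n)} → w ≢ [] → map suc w ≢ []
      map≢[] {[]}    w≢[] _ = w≢[] refl
      map≢[] {_ ∷ _} _ ()

    allFin-suc : zero ∷ map suc (allFin n) ≡ allFin (suc n)
    allFin-suc = cong (zero ∷_) (map-tabulate id suc)

    ws-correct : ∀ j → ⟦ ws ⟧ j ≡ lift₀ τ ⟨$⟩ʳ j
    ws-correct zero    = ⟦⟧-∉ ws zero∉ws
    ws-correct (suc j) = trans (⟦⟧-suc τ.words j) (cong suc (τ.correct j))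

    by-cases : ∀ i → (∀ j → lift₀ τ ⟨$⟩ʳ (transpose zero i ⟨$⟩ʳ j) ≡ σ ⟨$⟩ʳ j) →
               CycleDecomposition σ
    by-cases zero peel = record
      { words    = (zero ∷ []) ∷ ws
      ; nonEmpty = (λ ()) ∷ ws-nonEmpty
      ; disjoint = ↭-trans (↭-prep zero concat-ws) (↭-reflexive allFin-suc)
      ; correct  = λ j → trans (singleton (⟦ ws ⟧ j))
                     (trans (ws-correct j)
                       (trans (cong (lift₀ τ ⟨$⟩ʳ_) (sym (transpose-id j))) (peel j)))
      }
      where
      singleton : ∀ j → cycle (zero ∷ []) j ≡ j
      singleton zero    = refl
      singleton (suc j) = refl
      transpose-id : ∀ j → transpose zero zero ⟨$⟩ʳ j ≡ j
      transpose-id zero    = refl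
      transpose-id (suc j) = refl
    by-cases (suc i) peel = record
      { words    = insertAll ws
      ; nonEmpty = insertAll-nonEmpty ws-nonEmpty
      ; disjoint = ↭-trans (insertAll-↭ ws i∈ws)
                     (↭-trans (↭-prep zero concat-ws) (↭-reflexive allFin-suc))
      ; correct  = λ j → trans (⟦insertAll⟧ ws i∈ws zero∉ws j)
                     (trans (ws-correct (t j))
                       (trans (cong (lift₀ τ ⟨$⟩ʳ_) (transpose-sym j)) (peel j)))
      }
      where
      open Insert (suc i) zero
      i∈ws : suc i ∈ concat ws
      i∈ws = ∈-resp-↭ (↭-sym concat-ws) (∈-map⁺ suc (∈-allFin i))
      transpose-sym : ∀ j → t j ≡ transpose zero (suc i) ⟨$⟩ʳ j
      transpose-sym zero    = refl
      transpose-sym (suc j) with does (j ≟ i)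
      ... | true  = refl
      ... | false = refl

cycleDecomposition : (σ : Permutation′ n) → CycleDecomposition σ
cycleDecomposition {zero}  σ = record
  { words = [] ; nonEmpty = [] ; disjoint = ↭-refl ; correct = λ () }
cycleDecomposition {suc n} σ = cycleDecomposition′ τ σ i peel (cycleDecomposition τ)
  where open Peel σ

CharacteristicZero : HeytingField c ℓ₁ ℓ₂ → Set ℓ₂
CharacteristicZero K = ∀ r → (suc r ×ᴷ 1#) # 0#
  where
  open HeytingField K
  open RawSemiringDefinitions (RawRing.rawSemiring (rawRing K)) using () renaming (_×_ to _×ᴷ_)

module Scalars (K : HeytingField c ℓ₁ ℓ₂) (K₀ : CharacteristicZero K) where
  open HeytingField K using (1#; 0#; _*_; -_; _-_)
  private
    module K  = HeytingField K
    module KP = RingProperties (CommutativeRing.ring (commutativeRing K))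
  open RawSemiringDefinitions (RawRing.rawSemiring (rawRing K)) using () renaming (_×_ to _×ᴷ_)
  open Definitions K._≈_ using (Invertible)

  Scalar : Set c
  Scalar = HeytingField.Carrier K

  fromℕ : ℕ → Scalar
  fromℕ r = r ×ᴷ 1#

  Unit : Set _
  Unit = Σ Scalar (Invertible 1# _*_)

  one : Unit
  one = 1# , 1# , K.*-identityˡ 1# , K.*-identityˡ 1#

  minus : Unit → Unit
  minus (a , b , ba≈1 , ab≈1) = - a , - b
    , K.trans (-x*-y≈xy b a) ba≈1
    , K.trans (-x*-y≈xy a b) ab≈1
    where
    -x*-y≈xy : ∀ x y → - x * - y K.≈ x * y
    -x*-y≈xy x y = K.trans (K.sym (KP.-‿distribˡ-* x (- y)))
      (K.trans (K.-‿cong (K.sym (KP.-‿distribʳ-* x y))) (KP.-‿involutive (x * y)))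

  two : Unit
  two = fromℕ 2 , proj₁ inv
    , K.trans (K.*-congˡ (K.sym eq)) (proj₁ (proj₂ inv))
    , K.trans (K.*-congʳ (K.sym eq)) (proj₂ (proj₂ inv))
    where
    inv = K.#⇒invertible (K₀ 1)
    eq : fromℕ 2 - 0# K.≈ fromℕ 2
    eq = K.trans (K.+-congˡ KP.-0#≈0#) (K.+-identityʳ _)

  -- (a u + b)⁻¹ = a⁻¹ (u - (- a⁻¹ b))⁻¹
  [_u+_]⁻¹ : Unit → Scalar → ℕ → Scalar
  [ (a , a⁻¹ , _) u+ b ]⁻¹ r = a⁻¹ * [u-_]⁻¹ (rawRing K) (- (a⁻¹ * b)) r

  -- Given w⁻¹ as a series without constant term in u⁻¹, the expansion of
  -- f(w) = Σ_s f(s) w⁻ˢ; only s ≤ r contributes to the coefficient of u⁻ʳ.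
  module _ {a} (A : RawRing c a) (embed : Scalar → RawRing.Carrier A) where
    private
      module A = RawRing A
      open RawSemiringDefinitions A.rawSemiring using (sum)
      open RawSemiringDefinitions (RawRing.rawSemiring (Series (rawRing K)))
        using () renaming (_^_ to _^ˢ_)

    substitute : (w⁻¹ : ℕ → Scalar) → (ℕ → A.Carrier) → ℕ → A.Carrier
    substitute w⁻¹ f r = sum {suc r} λ s → embed ((w⁻¹ ^ˢ toℕ s) r) A.* f (toℕ s)

module ReflectionAlgebra (K : HeytingField c ℓ₁ ℓ₂) (K₀ : CharacteristicZero K) (m l : ℕ) where
  open Scalars K K₀
  private
    module K = HeytingField K

  N : ℕ
  N = m ℕ.+ l

  ε : Fin N → Scalar
  ε i = [ const K.1# , const (K.- K.1#) ]′ (splitAt m i)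

  Generator : Set
  Generator = Fin N × Fin N × ℕ

  Terms : RawRing c c
  Terms = rawTerms (rawRing K) Generator

  private
    module T = RawRing Terms

  b : Fin N → Fin N → ℕ → T.Carrier
  b i j r = generator (i , j , r)

  -- The reflection equation is read in End(Kᴺ)^⊗2 ⊗ A((v⁻¹))[[u⁻¹]], so
  -- that (u ∓ v)⁻¹ is expanded in powers of u⁻¹.
  module ReflectionEquation where
    L UV : RawRing c c
    L  = Laurent Terms
    UV = Series L

    v : RawRing.Carrier L
    v = 1 , RawRing.1# (Series Terms)

    [u-v]⁻¹ [u+v]⁻¹ : RawRing.Carrier UV
    [u-v]⁻¹ = [u-_]⁻¹ L v
    [u+v]⁻¹ = [u-_]⁻¹ L (RawRing.-_ L v)

    open Tensor UV
    open RawRing (Matrix (N ^ 2)) using (_+_; _*_; -_; 1#)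

    R : RawRing.Carrier UV → Mat (N ^ 2)
    R w⁻¹ = 1# + - (w⁻¹ ∙ P {p = 2} {n = N} zero (suc zero))

    B₁[u] B₂[v] : Mat (N ^ 2)
    B₁[u] = slot {p = 2} {n = N} zero λ i j r → 0 , constant Terms (b i j r)
    B₂[v] = slot {p = 2} {n = N} (suc zero) λ i j → constant L (0 , b i j)

    lhs rhs : Mat (N ^ 2)
    lhs = R [u-v]⁻¹ * B₁[u] * R [u+v]⁻¹ * B₂[v]
    rhs = B₂[v] * R [u+v]⁻¹ * B₁[u] * R [u-v]⁻¹

  module UnitaryCondition where
    open Tensor (Series Terms) using (Mat; Matrix)

    B[u] B[-u] : Mat N
    B[u]  = b
    B[-u] i j = substitute Terms scalar [ minus one u+ K.0# ]⁻¹ (b i j)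

    lhs rhs : Mat N
    lhs = RawRing._*_ (Matrix N) B[u] B[-u]
    rhs = RawRing.1# (Matrix N)

  data Relation : T.Carrier → T.Carrier → Set c where
    initial    : ∀ i j → Relation (b i j 0) (scalar (if does (i ≟ j) then ε i else K.0#))
    reflection : ∀ I J r z → let open ReflectionEquation in
                 Relation (coefficient Terms (lhs I J r) z) (coefficient Terms (rhs I J r) z)
    unitary    : ∀ i j r → let open UnitaryCondition in Relation (lhs i j r) (rhs i j r)

  algebra : Ring c (c ⊔ ℓ₁)
  algebra = Presented.ring (rawRing K) Generator Relation

  𝓑 : RawRing c (c ⊔ ℓ₁)
  𝓑 = Ring.rawRing algebra

  𝓑⟦u⁻¹⟧ : RawRing c (c ⊔ ℓ₁)
  𝓑⟦u⁻¹⟧ = Series 𝓑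

  open Tensor 𝓑⟦u⁻¹⟧ public

  -- Matrices over 𝓑⟦u⁻¹⟧ in the basis of (Kᴺ)^⊗N, i.e. End(Kᴺ)^⊗N ⊗ 𝓑⟦u⁻¹⟧.
  End : RawRing c (c ⊔ ℓ₁)
  End = Matrix (N ^ N)

  private
    module End = RawRing End

  infixr 8 _·_
  _·_ : (ℕ → Scalar) → End.Carrier → End.Carrier
  f · X = (scalar ∘ f) ∙ X

  B[u-_] : ℕ → Mat N
  B[u- k ] i j = substitute 𝓑 scalar [ one u+ K.- fromℕ k ]⁻¹ (b i j)

  -- Fin N is 0-based, the formulas for Πₖ and ᾱ are 1-based.
  index : Fin N → ℕ
  index i = suc (toℕ i)

  ∑ : ∀ {A : Set} → List A → (A → End.Carrier) → End.Carrier
  ∑ xs f = foldr (λ x → End._+_ (f x)) End.0# xs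

  ∏ : ∀ {q} → (Fin q → End.Carrier) → End.Carrier
  ∏ = RawSemiringDefinitions.product End.rawSemiring

  -- Πₖ = 1 - (2u - k - N + 2)⁻¹ Σ_{i > k} Pₖᵢ
  Π : Fin N → End.Carrier
  Π k = End.1# End.+ End.- (
    [ two u+ (fromℕ 2 K.- fromℕ (index k) K.- fromℕ N) ]⁻¹
      · ∑ (filter (k Fin.<?_) (allFin N)) (λ i → P k i))

  -- X₁ Y₁ X₂ ⋯ Y_{q-1} X_q: the last Y does not occur.
  interleave : ∀ {q} → (Fin q → End.Carrier) → (Fin q → End.Carrier) → End.Carrier
  interleave {zero}        X Y = End.1#
  interleave {suc zero}    X Y = X zero
  interleave {suc (suc q)} X Y =
    X zero End.* Y zero End.* interleave (X ∘ suc) (Y ∘ suc)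

  ⟪B⟫ : End.Carrier
  ⟪B⟫ = interleave (λ k → slot k B[u- toℕ k ]) Π

  -- ∏ (N - 2u - 2 + g)⁻¹ over the g that are not maximal in their cycle
  ᾱ : ∀ {σ : Permutation′ N} → CycleDecomposition σ → ℕ → Scalar
  ᾱ d = foldr
    (λ g → RawRing._*_ (Series (rawRing K))
             [ minus two u+ (fromℕ N K.- fromℕ 2 K.+ fromℕ (index g)) ]⁻¹)
    (RawRing.1# (Series (rawRing K)))
    (CycleDecomposition.nonMaxima d)

{-# OPTIONS --safe #-}

-- Put aₖ = 1 / (n - 2u - 2 + k), so that Πₖ = 1 + aₖ Σ_{i > k} P_{ki}. Expanding
-- all the Πₖ gives a sum over the choices of iₖ ≥ k for every k, where iₖ = k
-- stands for the summand 1 and each iₖ > k contributes a factor aₖ. By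
-- π X_s = X_{π(s)} π all transpositions can be moved to the left. They become
-- σ⁻¹ for σ = (n iₙ) ⋯ (2 i₂) (1 i₁), and the k-th matrix ends up in position
-- σₖ(k), where σₖ = (n iₙ) ⋯ (k iₖ). Every σ arises from exactly one choice.
-- Since σₖ = σₖ₊₁ (k iₖ), and σₖ₊₁ fixes k, the cycles of σₖ₊₁ are those of σₖ
-- with k deleted. Hence σₖ is the word restriction of σ on {k, …, n}, and k is
-- maximal in its cycle of σ if and only if σₖ(k) = k, that is iₖ = k.
module Submission where

open import Defs hiding (rawRing; commutativeRing)
open import Defs using () renaming (rawRing to fieldRawRing; commutativeRing to fieldCommutativeRing)
open import Algebra.Apartness.Bundles using (HeytingField)
open import Algebra.Bundles using (CommutativeRing; RawRing; Ring; Semiring)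
import Algebra.Construct.Pointwise as Pointwise
import Algebra.Definitions.RawSemiring as RawSemiringDefinitions
import Algebra.Properties.Ring as RingProperties
import Algebra.Properties.Semiring.Exp as SemiringExp
import Algebra.Properties.Semiring.Sum as Sum
open import Data.Bool.Base using (Bool; true; false; if_then_else_; not; _∧_)
open import Data.Bool.Properties using (¬-not)
import Data.Bool.Properties as Bool
open import Data.Fin.Base using (Fin; zero; suc; toℕ; finToFun; funToFin; combine)
import Data.Fin.Base as Fin
open import Data.Fin.Permutation
  using (Permutation′; flip; _∘ₚ_; _⟨$⟩ʳ_; _⟨$⟩ˡ_; inverseˡ; inverseʳ; transpose; lift₀;
         lift₀-cong; lift₀-id; lift₀-comp; lift₀-transpose)
import Data.Fin.Permutation as Perm
open import Data.Fin.Properties using (_≟_; all?; ¬∀⟶∃¬; finToFun-funToFin; funToFin-finToFin)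
import Data.Fin.Properties as Fin
open import Data.List.Base
  using (List; []; _∷_; _++_; map; filter; foldr; concat; allFin; tabulate; cartesianProductWith)
open import Data.List.Membership.Propositional using (_∈_; _∉_)
open import Data.List.Membership.Propositional.Properties using (∈-allFin; ∈-++⁺ˡ; ∈-++⁺ʳ)
open import Data.List.Properties using (filter-all; filter-none; map-id-local; map-tabulate)
open import Data.List.Relation.Binary.Permutation.Propositional
  using (_↭_; prep; swap; ↭-refl; ↭-sym; ↭-trans; ↭-prep; ↭-swap; ↭-reflexive; ↭⇒↭ₛ)
open import Data.List.Relation.Binary.Permutation.Propositional.Properties using (∈-resp-↭)
import Data.List.Relation.Binary.Permutation.Setoid.Properties as SetoidPermutation
open import Data.List.Relation.Unary.All using (All; []; _∷_)
import Data.List.Relation.Unary.All as All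
import Data.List.Relation.Unary.All.Properties as All
open import Data.List.Relation.Unary.AllPairs using (_∷_)
open import Data.List.Relation.Unary.Any using (Any; here; there)
import Data.List.Relation.Unary.Any as Any
import Data.List.Relation.Unary.Any.Properties as Any
open import Data.List.Relation.Unary.Unique.Propositional using (Unique)
open import Data.List.Relation.Unary.Unique.Propositional.Properties using (allFin⁺)
open import Data.Nat.Base using (ℕ; zero; suc; _∸_; _^_; z≤n; s≤s)
import Data.Nat.Base as ℕ
import Data.Nat.Properties as ℕ
open import Data.Product.Base using (_×_; _,_; proj₁)
open import Data.Sum.Base using (_⊎_; inj₁; inj₂)
open import Function.Base using (_∘_; id)
open import Function.Bundles using (_⇔_; mk⇔; module Equivalence)
open import Level using (_⊔_)
open import Relation.Binary.PropositionalEquality as ≡ using (_≡_; _≢_; _≗_; cong; cong₂)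
import Relation.Binary.Reasoning.Setoid as ≈-Reasoning
open import Relation.Nullary using (Dec; does; yes; no; ¬?; contradiction)
open import Relation.Nullary.Decidable using (_×-dec_; dec-true; dec-false; does-⇔)
open import Relation.Unary using (Pred; Decidable)

open DecidableMembership using (_∈?_)

-- The induction splits off the first factor. The remaining factors form a product of the same kind
-- for the permutations of {2, ..., n}, and its expansion is indexed by τ with σ = τ (1 i₁). The
-- k-th matrix is moved only past the transpositions to its right, those coming from indices at
-- least k, which is why its position involves σₖ and not σ. The obstacle is that the cycle words
-- are an arbitrary choice for each σ, with no relation between the words of different permutations.
-- Hence the words of τ are never chosen: they are those of σ with 1 deleted, and the expansion is
-- proved for every family of words. This works for any order of the cycles and any starting point
-- in each word, because deleting a letter only redirects its predecessor to its successor.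

private variable
  n p q : ℕ

-- Deleting the minimal element from a cycle decomposition

shrink : List (Fin (suc n)) → List (Fin n)
shrink []          = []
shrink (zero  ∷ w) = shrink w
shrink (suc x ∷ w) = x ∷ shrink w

shrink-map-suc : (v : List (Fin n)) → shrink (map suc v) ≡ v
shrink-map-suc []      = ≡.refl
shrink-map-suc (x ∷ v) = cong (x ∷_) (shrink-map-suc v)

map-suc-shrink : (w : List (Fin (suc n))) → zero ∉ w → map suc (shrink w) ≡ w
map-suc-shrink []          0∉ = ≡.refl
map-suc-shrink (zero  ∷ w) 0∉ = contradiction (here ≡.refl) 0∉
map-suc-shrink (suc x ∷ w) 0∉ = cong (suc x ∷_) (map-suc-shrink w (0∉ ∘ there))

shrink-++ : (w r : List (Fin (suc n))) → shrink (w ++ r) ≡ shrink w ++ shrink r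
shrink-++ []          r = ≡.refl
shrink-++ (zero  ∷ w) r = shrink-++ w r
shrink-++ (suc x ∷ w) r = cong (x ∷_) (shrink-++ w r)

shrink-concat : (ws : List (List (Fin (suc n)))) → concat (map shrink ws) ≡ shrink (concat ws)
shrink-concat []       = ≡.refl
shrink-concat (w ∷ ws) = ≡.trans (cong (shrink w ++_) (shrink-concat ws)) (≡.sym (shrink-++ w (concat ws)))

shrink-↭ : {w r : List (Fin (suc n))} → w ↭ r → shrink w ↭ shrink r
shrink-↭ _↭_.refl                   = ↭-refl
shrink-↭ (prep zero    w↭r)         = shrink-↭ w↭r
shrink-↭ (prep (suc x) w↭r)         = ↭-prep x (shrink-↭ w↭r)
shrink-↭ (swap zero    zero    w↭r) = shrink-↭ w↭r
shrink-↭ (swap zero    (suc y) w↭r) = ↭-prep y (shrink-↭ w↭r)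
shrink-↭ (swap (suc x) zero    w↭r) = ↭-prep x (shrink-↭ w↭r)
shrink-↭ (swap (suc x) (suc y) w↭r) = ↭-swap x y (shrink-↭ w↭r)
shrink-↭ (_↭_.trans w↭r r↭s)        = ↭-trans (shrink-↭ w↭r) (shrink-↭ r↭s)

allFin-suc : ∀ n → allFin (suc n) ≡ zero ∷ map suc (allFin n)
allFin-suc n = cong (zero ∷_) (≡.sym (map-tabulate id suc))

shrink-allFin : ∀ n → shrink (allFin (suc n)) ≡ allFin n
shrink-allFin n = ≡.trans (cong shrink (allFin-suc n)) (shrink-map-suc (allFin n))

-- Exhibits the position of the unique occurrence of `zero`, so that a recursion can follow the walk
-- `Cycle.go` up to `zero` and treat the step across it separately.
data Once {n} : List (Fin (suc n)) → Set where
  here  : ∀ {w} → zero ∉ w → Once (zero ∷ w)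
  there : ∀ {x w} → Once w → Once (suc x ∷ w)

once : {w : List (Fin (suc n))} → Unique w → zero ∈ w → Once w
once {w = zero  ∷ w} (0≢ ∷ _) _          = here λ 0∈w → All.lookup 0≢ 0∈w ≡.refl
once {w = suc x ∷ w} (_ ∷ u)  (there 0∈) = there (once u 0∈)

once-++⁻ : (w : List (Fin (suc n))) {r : List (Fin (suc n))} → Once (w ++ r) →
           (Once w × zero ∉ r) ⊎ (zero ∉ w × Once r)
once-++⁻ []          o         = inj₂ ((λ ()) , o)
once-++⁻ (zero  ∷ w) (here 0∉) = inj₁ (here (0∉ ∘ ∈-++⁺ˡ) , 0∉ ∘ ∈-++⁺ʳ w)
once-++⁻ (suc x ∷ w) (there o) with once-++⁻ w o
... | inj₁ (ow , 0∉r) = inj₁ (there ow , 0∉r)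
... | inj₂ (0∉w , or) = inj₂ ((λ { (there 0∈w) → 0∉w 0∈w }) , or)

cycle-map-suc-zero : (v : List (Fin n)) → cycle (map suc v) zero ≡ zero
cycle-map-suc-zero []      = ≡.refl
cycle-map-suc-zero (a ∷ v) = go a v
  where
  go : ∀ x u → Cycle.go (suc a) (map suc v) zero (suc x) (map suc u) ≡ zero
  go x []      = ≡.refl
  go x (y ∷ u) = go y u

-- `w′` is left arbitrary because `cycle-shrink` follows the walk beyond `zero`, where the remaining
-- letters are successors but the ambient word still contains `zero`.
cycle-go-suc : ∀ (a j : Fin n) (w : List (Fin n)) (w′ : List (Fin (suc n))) x u →
  Cycle.go (suc a) w′ (suc j) (suc x) (map suc u) ≡ suc (Cycle.go a w j x u)
cycle-go-suc a j w w′ x []      with does (j ≟ x)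
... | true  = ≡.refl
... | false = ≡.refl
cycle-go-suc a j w w′ x (y ∷ u) with does (j ≟ x)
... | true  = ≡.refl
... | false = cycle-go-suc a j w w′ y u

cycle-map-suc : (v : List (Fin n)) (j : Fin n) → cycle (map suc v) (suc j) ≡ suc (cycle v j)
cycle-map-suc []      j = ≡.refl
cycle-map-suc (a ∷ v) j = cycle-go-suc a j v (map suc v) a v

cycle-zero-∉ : (w : List (Fin (suc n))) → zero ∉ w → cycle w zero ≡ zero
cycle-zero-∉ w 0∉w =
  ≡.subst (λ w → cycle w zero ≡ zero) (map-suc-shrink w 0∉w) (cycle-map-suc-zero (shrink w))

cycle-suc-∉ : (w : List (Fin (suc n))) → zero ∉ w → ∀ j → cycle w (suc j) ≡ suc (cycle (shrink w) j)
cycle-suc-∉ w 0∉w j =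
  ≡.subst (λ w′ → cycle w′ (suc j) ≡ suc (cycle (shrink w) j)) (map-suc-shrink w 0∉w) (cycle-map-suc (shrink w) j)

⟦⟧-zero-∉ : (ws : List (List (Fin (suc n)))) → zero ∉ concat ws → ⟦ ws ⟧ zero ≡ zero
⟦⟧-zero-∉ []       0∉ = ≡.refl
⟦⟧-zero-∉ (w ∷ ws) 0∉ =
  ≡.trans (cong (cycle w) (⟦⟧-zero-∉ ws (0∉ ∘ ∈-++⁺ʳ w))) (cycle-zero-∉ w (0∉ ∘ ∈-++⁺ˡ))

⟦⟧-suc-∉ : (ws : List (List (Fin (suc n)))) → zero ∉ concat ws →
           ∀ j → ⟦ ws ⟧ (suc j) ≡ suc (⟦ map shrink ws ⟧ j)
⟦⟧-suc-∉ []       0∉ j = ≡.refl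
⟦⟧-suc-∉ (w ∷ ws) 0∉ j =
  ≡.trans (cong (cycle w) (⟦⟧-suc-∉ ws (0∉ ∘ ∈-++⁺ʳ w) j)) (cycle-suc-∉ w (0∉ ∘ ∈-++⁺ˡ) _)

-- For f a permutation, j ↦ skip (f zero) (f (suc j)) bypasses zero in the
-- cycles of f.
skip : Fin (suc n) → Fin (suc n) → Fin (suc n)
skip z zero    = z
skip z (suc y) = suc y

-- Deleting `zero` affects only the letter before it, which is sent to the letter after it,
-- cyclically; that letter is the image of `zero`.
cycle-shrink : {w : List (Fin (suc n))} → Once w → ∀ j →
               suc (cycle (shrink w) j) ≡ skip (cycle w zero) (cycle w (suc j))
-- The word begins with `zero`, so the last letter is its predecessor, and closing the shortened
-- cycle leads to the second letter.
cycle-shrink (here {w} 0∉w) j = ≡.subst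
  (λ w → suc (cycle (shrink w) j) ≡ skip (cycle (zero ∷ w) zero) (cycle (zero ∷ w) (suc j)))
  (map-suc-shrink w 0∉w) (head-zero (shrink w))
  where
  head-zero : ∀ v → suc (cycle (shrink (map suc v)) j) ≡
              skip (cycle (zero ∷ map suc v) zero) (cycle (zero ∷ map suc v) (suc j))
  head-zero v rewrite shrink-map-suc v = head-zero′ v
    where
    head-zero′ : ∀ v → suc (cycle v j) ≡
                skip (cycle (zero ∷ map suc v) zero) (cycle (zero ∷ map suc v) (suc j))
    head-zero′ []      = ≡.refl
    head-zero′ (b ∷ v) = go b v
      where
      go : ∀ x u → suc (Cycle.go b v j x u) ≡
           skip (suc b) (Cycle.go zero (map suc (b ∷ v)) (suc j) (suc x) (map suc u))
      go x []      with does (j ≟ x)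
      ... | true  = ≡.refl
      ... | false = ≡.refl
      go x (y ∷ u) with does (j ≟ x)
      ... | true  = ≡.refl
      ... | false = go y u
cycle-shrink {n} (there {a} {w} o) j = go a o
  where
  c′ : Fin (suc n) → Fin (suc n) → List (Fin (suc n)) → Fin (suc n)
  c′ = Cycle.go (suc a) w
  -- Here `suc x` stands right before `zero`. If nothing follows `zero`, its image is the first
  -- letter `suc a` of the word.
  after : ∀ x v → suc (Cycle.go a (shrink w) j x (shrink (map suc v))) ≡
          skip (c′ zero (suc x) (zero ∷ map suc v)) (c′ (suc j) (suc x) (zero ∷ map suc v))
  after x v rewrite shrink-map-suc v with v
  ... | []    with does (j ≟ x)
  ...   | true  = ≡.refl
  ...   | false = ≡.refl
  after x _ | y ∷ u with does (j ≟ x)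
  ...   | true  = ≡.refl
  ...   | false = ≡.sym (cong (skip (suc y)) (cycle-go-suc a j (shrink w) w y u))
  go : ∀ x {v} → Once v → suc (Cycle.go a (shrink w) j x (shrink v)) ≡
       skip (c′ zero (suc x) v) (c′ (suc j) (suc x) v)
  go x (here {v} 0∉v) = ≡.subst
    (λ v → suc (Cycle.go a (shrink w) j x (shrink v)) ≡
           skip (c′ zero (suc x) (zero ∷ v)) (c′ (suc j) (suc x) (zero ∷ v)))
    (map-suc-shrink v 0∉v) (after x (shrink v))
  go x (there {y} o) with does (j ≟ x)
  ... | true  = ≡.refl
  ... | false = go y o

-- Only one word contains `zero`, and there `cycle-shrink` applies. The other cycles fix `zero` and
-- map successors to successors, so bypassing `zero` commutes with them.
⟦⟧-shrink : (ws : List (List (Fin (suc n)))) → Once (concat ws) →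
            ∀ j → suc (⟦ map shrink ws ⟧ j) ≡ skip (⟦ ws ⟧ zero) (⟦ ws ⟧ (suc j))
⟦⟧-shrink (w ∷ ws) o j with once-++⁻ w o
... | inj₁ (ow , 0∉ws)
  rewrite ⟦⟧-zero-∉ ws 0∉ws | ⟦⟧-suc-∉ ws 0∉ws j = cycle-shrink ow _
... | inj₂ (0∉w , ows) with ⟦ ws ⟧ (suc j) | ⟦⟧-shrink ws ows j
...   | zero  | eq rewrite cycle-zero-∉ w 0∉w =
  ≡.trans (≡.sym (cycle-suc-∉ w 0∉w _)) (cong (cycle w) eq)
...   | suc y | eq rewrite cycle-suc-∉ w 0∉w y = cong (suc ∘ cycle (shrink w)) (Fin.suc-injective eq)

-- Maximal letters and word restrictions

-- Stated for bare lists of words, like the next three definitions, because shrinking can produce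
-- empty words, which a `CycleDecomposition` excludes.
IsMaximum : List (List (Fin n)) → Fin n → Set
IsMaximum ws g = Any (λ w → g ∈ w × All (Fin._≤ g) w) ws

isMaximum? : (ws : List (List (Fin n))) → ∀ g → Dec (IsMaximum ws g)
isMaximum? ws g = Any.any? (λ w → (g ∈? w) ×-dec All.all? (Fin._≤? g) w) ws

nonMaximaOf : List (List (Fin n)) → List (Fin n)
nonMaximaOf ws = filter (¬? ∘ isMaximum? ws) (allFin _)

restrictFrom : List (List (Fin n)) → Fin n → Fin n → Fin n
restrictFrom ws i = ⟦ map (filter (i Fin.≤?_)) ws ⟧

∈-shrink⁺ : {g : Fin n} {w : List (Fin (suc n))} → suc g ∈ w → g ∈ shrink w
∈-shrink⁺ {w = zero  ∷ w} (there g∈)     = ∈-shrink⁺ g∈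
∈-shrink⁺ {w = suc x ∷ w} (here ≡.refl)  = here ≡.refl
∈-shrink⁺ {w = suc x ∷ w} (there g∈)     = there (∈-shrink⁺ g∈)

∈-shrink⁻ : {g : Fin n} {w : List (Fin (suc n))} → g ∈ shrink w → suc g ∈ w
∈-shrink⁻ {w = zero  ∷ w} g∈            = there (∈-shrink⁻ g∈)
∈-shrink⁻ {w = suc x ∷ w} (here ≡.refl) = here ≡.refl
∈-shrink⁻ {w = suc x ∷ w} (there g∈)    = there (∈-shrink⁻ g∈)

-- The letter `zero` lies below `suc g`, so its presence never decides whether `suc g` is maximal in
-- a word.
isMaximum-shrink : (ws : List (List (Fin (suc n)))) (g : Fin n) →
                   IsMaximum ws (suc g) ⇔ IsMaximum (map shrink ws) g
isMaximum-shrink ws g = mk⇔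
  (Any.map⁺ ∘ Any.map λ { (g∈ , w≤g) →
    ∈-shrink⁺ g∈ , All.tabulate λ x∈ → ℕ.s≤s⁻¹ (All.lookup w≤g (∈-shrink⁻ x∈)) })
  (Any.map (λ { (g∈ , w≤g) →
    ∈-shrink⁻ g∈ , All.tabulate λ { {zero}  _  → z≤n
                                  ; {suc x} x∈ → s≤s (All.lookup w≤g (∈-shrink⁺ x∈)) } }) ∘ Any.map⁻)

-- The word starts with a successor and has no second `zero`, so both the next letter and, on
-- wrapping around, the first letter differ from `zero`.
cycle-moves-zero : ∀ {x : Fin n} {w} → Once w → cycle (suc x ∷ w) zero ≢ zero
cycle-moves-zero {n} {a} {w} o = go a o
  where
  after : ∀ {v} → zero ∉ v → Cycle.go (suc a) w zero zero v ≢ zero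
  after {[]}        0∉v ()
  after {zero  ∷ v} 0∉v _  = 0∉v (here ≡.refl)
  after {suc x ∷ v} 0∉v ()
  go : ∀ x {v} → Once v → Cycle.go (suc a) w zero (suc x) v ≢ zero
  go x (here 0∉v)    = after 0∉v
  go x (there {y} o) = go y o

-- As the least letter, `zero` is maximal only when its word has no other letter. In any longer word
-- its single occurrence is followed, cyclically, by a different letter.
isMaximum-zero : (ws : List (List (Fin (suc n)))) → Once (concat ws) →
                 IsMaximum ws zero ⇔ ⟦ ws ⟧ zero ≡ zero
isMaximum-zero {n} (w ∷ ws) o with once-++⁻ w o
... | inj₂ (0∉w , ows) = mk⇔
  (λ { (here (0∈w , _)) → contradiction 0∈w 0∉w
     ; (there max) → ≡.trans (cong (cycle w) (Equivalence.to IH max)) (cycle-zero-∉ w 0∉w) })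
  (there ∘ Equivalence.from IH ∘ reflects)
  where
  IH = isMaximum-zero ws ows
  -- Without the letter `zero`, `w` maps successors to successors, so only `zero` can land on
  -- `zero`.
  reflects : cycle w (⟦ ws ⟧ zero) ≡ zero → ⟦ ws ⟧ zero ≡ zero
  reflects eq with ⟦ ws ⟧ zero
  ... | zero  = ≡.refl
  ... | suc y with () ← ≡.trans (≡.sym eq) (cycle-suc-∉ w 0∉w y)
... | inj₁ (ow , 0∉ws) rewrite ⟦⟧-zero-∉ ws 0∉ws = mk⇔
  (λ { (here (_ , w≤0)) → fixed ow w≤0
     ; (there max) → contradiction (Any.concat⁺ (Any.map proj₁ max)) 0∉ws })
  (here ∘ maximal ow)
  where
  fixed : ∀ {w : List (Fin (suc n))} → Once w → All (Fin._≤ zero {n}) w → cycle w zero ≡ zero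
  fixed (here {[]}        0∉v) _            = ≡.refl
  fixed (here {zero  ∷ v} 0∉v) _            = contradiction (here ≡.refl) 0∉v
  fixed (here {suc x ∷ v} 0∉v) (_ ∷ () ∷ _)
  fixed (there o)              (() ∷ _)
  maximal : ∀ {w : List (Fin (suc n))} → Once w → cycle w zero ≡ zero → zero ∈ w × All (Fin._≤ zero {n}) w
  maximal (here {[]}        0∉v) _  = here ≡.refl , z≤n ∷ []
  maximal (here {zero  ∷ v} 0∉v) _  = contradiction (here ≡.refl) 0∉v
  maximal (here {suc x ∷ v} 0∉v) ()
  maximal (there o)              eq = contradiction eq (cycle-moves-zero o)

filter-map : ∀ {a b p q} {A : Set a} {B : Set b} {P : Pred B p} {Q : Pred A q}
             (P? : Decidable P) (Q? : Decidable Q) (f : A → B) →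
             (∀ x → does (P? (f x)) ≡ does (Q? x)) →
             ∀ xs → filter P? (map f xs) ≡ map f (filter Q? xs)
filter-map P? Q? f eq []       = ≡.refl
filter-map P? Q? f eq (x ∷ xs) rewrite eq x with does (Q? x)
... | true  = cong (f x ∷_) (filter-map P? Q? f eq xs)
... | false = filter-map P? Q? f eq xs

module _ (ws : List (List (Fin (suc n)))) where
  private
    nonMaxima-tail : filter (¬? ∘ isMaximum? ws) (tabulate suc) ≡ map suc (nonMaximaOf (map shrink ws))
    nonMaxima-tail = ≡.trans
      (cong (filter (¬? ∘ isMaximum? ws)) (≡.sym (map-tabulate id suc)))
      (filter-map (¬? ∘ isMaximum? ws) (¬? ∘ isMaximum? (map shrink ws)) suc
        (λ g → cong not
          (does-⇔ (isMaximum-shrink ws g) (isMaximum? ws (suc g)) (isMaximum? (map shrink ws) g)))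
        (allFin n))

  nonMaxima-fixed : Once (concat ws) → ⟦ ws ⟧ zero ≡ zero →
                    nonMaximaOf ws ≡ map suc (nonMaximaOf (map shrink ws))
  nonMaxima-fixed o fixed
    rewrite dec-true (isMaximum? ws zero) (Equivalence.from (isMaximum-zero ws o) fixed) = nonMaxima-tail

  nonMaxima-moved : Once (concat ws) → ⟦ ws ⟧ zero ≢ zero →
                    nonMaximaOf ws ≡ zero ∷ map suc (nonMaximaOf (map shrink ws))
  nonMaxima-moved o moved
    rewrite dec-false (isMaximum? ws zero) (moved ∘ Equivalence.to (isMaximum-zero ws o)) =
    cong (zero ∷_) nonMaxima-tail

restrictFrom-zero : (ws : List (List (Fin (suc n)))) → restrictFrom ws zero zero ≡ ⟦ ws ⟧ zero
restrictFrom-zero {n} ws = cong (λ ws → ⟦ ws ⟧ zero)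
  (map-id-local {f = filter (zero {n = n} Fin.≤?_)} {xs = ws}
    (All.tabulate λ _ → filter-all (zero {n = n} Fin.≤?_) (All.tabulate λ _ → z≤n)))

-- The filter from `suc k` on discards `zero` in any case, so `zero` may be deleted beforehand; only
-- the shift of indices remains.
restrictFrom-suc : (ws : List (List (Fin (suc n)))) (k : Fin n) →
                   restrictFrom ws (suc k) (suc k) ≡ suc (restrictFrom (map shrink ws) k k)
restrictFrom-suc {n} ws k = go ws k
  where
  does-≤?-suc : ∀ x → does (suc k Fin.≤? suc x) ≡ does (k Fin.≤? x)
  does-≤?-suc x = does-⇔ (mk⇔ ℕ.s≤s⁻¹ s≤s) (suc k Fin.≤? suc x) (k Fin.≤? x)
  filter-shrink : ∀ w → filter (suc k Fin.≤?_) w ≡ map suc (filter (k Fin.≤?_) (shrink w))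
  filter-shrink []          = ≡.refl
  filter-shrink (zero  ∷ w) = filter-shrink w
  filter-shrink (suc x ∷ w) rewrite does-≤?-suc x with does (k Fin.≤? x)
  ... | true  = cong (suc x ∷_) (filter-shrink w)
  ... | false = filter-shrink w
  go : ∀ ws j → ⟦ map (filter (suc k Fin.≤?_)) ws ⟧ (suc j) ≡
                suc (⟦ map (filter (k Fin.≤?_)) (map shrink ws) ⟧ j)
  go []       j = ≡.refl
  go (w ∷ ws) j rewrite go ws j | filter-shrink w = cycle-map-suc (filter (k Fin.≤?_) (shrink w)) _

-- A cycle decomposition in which empty words are allowed, as they arise from
-- (0) when 0 is deleted.
record CycleWords (σ : Permutation′ n) : Set where
  field
    words    : List (List (Fin n))
    disjoint : concat words ↭ allFin n
    correct  : ∀ i → ⟦ words ⟧ i ≡ σ ⟨$⟩ʳ i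

once-zero : {ws : List (List (Fin (suc n)))} → concat ws ↭ allFin (suc n) → Once (concat ws)
once-zero {n} ws↭ = once
  (SetoidPermutation.Unique-resp-↭ (≡.setoid _) (↭⇒↭ₛ (↭-sym ws↭)) (allFin⁺ (suc n)))
  (∈-resp-↭ (↭-sym ws↭) (∈-allFin zero))

-- Bypassing `zero` in τ ∘ (0 i) gives back τ: the point `i` goes to `zero`, while `zero` goes where
-- τ sends `i`, and no other point meets `zero`.
shrinkWords : {τ : Permutation′ n} {i : Fin (suc n)} →
              CycleWords (transpose zero i ∘ₚ lift₀ τ) → CycleWords τ
shrinkWords {n} {τ} {i} d = record
  { words    = map shrink words
  ; disjoint = ↭-trans (↭-reflexive (shrink-concat words))
                 (↭-trans (shrink-↭ disjoint) (↭-reflexive (shrink-allFin n)))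
  ; correct  = λ j → Fin.suc-injective (≡.trans (⟦⟧-shrink words (once-zero {ws = words} disjoint) j)
                 (≡.trans (cong₂ skip (correct zero) (correct (suc j))) (bypass i j)))
  }
  where
  open CycleWords d
  bypass : ∀ i j → skip ((transpose zero i ∘ₚ lift₀ τ) ⟨$⟩ʳ zero) ((transpose zero i ∘ₚ lift₀ τ) ⟨$⟩ʳ suc j)
           ≡ suc (τ ⟨$⟩ʳ j)
  bypass zero    j = ≡.refl
  bypass (suc i) j with j ≟ i
  ... | yes ≡.refl = ≡.refl
  ... | no  _      = ≡.refl

-- Expanding a product of sums of transpositions

-- The backward map of a transposition is defined by exchanging its two arguments; this comparison
-- lets `flip` of a transposition be treated as the transposition itself.
transpose-zero-comm : (i k : Fin (suc n)) → transpose zero i ⟨$⟩ˡ k ≡ transpose zero i ⟨$⟩ʳ k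
transpose-zero-comm zero    k    = ≡.refl
transpose-zero-comm (suc i) zero = ≡.refl
transpose-zero-comm (suc i) (suc k) with does (k ≟ i)
... | true  = ≡.refl
... | false = ≡.refl

filter-zero<? : ∀ q → filter (zero {q} Fin.<?_) (allFin (suc q)) ≡ map suc (allFin q)
filter-zero<? q = ≡.trans (filter-all (zero {q} Fin.<?_) (All.tabulate⁺ λ _ → s≤s z≤n)) (≡.sym (map-tabulate id suc))

filter-suc<? : (k : Fin q) → filter (suc k Fin.<?_) (allFin (suc q)) ≡ map suc (filter (k Fin.<?_) (allFin q))
filter-suc<? {q} k = ≡.trans (cong (filter (suc k Fin.<?_)) (≡.sym (map-tabulate {n = q} id suc)))
  (filter-map (suc k Fin.<?_) (k Fin.<?_) suc
    (λ x → does-⇔ (mk⇔ ℕ.s≤s⁻¹ s≤s) (suc k Fin.<? suc x) (k Fin.<? x)) (allFin q))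

module _ {c ℓ} (A : Semiring c ℓ) where
  open Semiring A hiding (zero)
  open RawSemiringDefinitions rawSemiring using (product)
  open ≈-Reasoning setoid

  private variable
    I J : Set

  listSum : List I → (I → Carrier) → Carrier
  listSum xs f = foldr (λ x → f x +_) 0# xs

  listSum-cong : (xs : List I) {f g : I → Carrier} → (∀ x → f x ≈ g x) → listSum xs f ≈ listSum xs g
  listSum-cong []       f≈g = refl
  listSum-cong (x ∷ xs) f≈g = +-cong (f≈g x) (listSum-cong xs f≈g)

  listSum-map : (h : I → J) (xs : List I) (f : J → Carrier) → listSum (map h xs) f ≡ listSum xs (f ∘ h)
  listSum-map h []       f = ≡.refl
  listSum-map h (x ∷ xs) f = cong (f (h x) +_) (listSum-map h xs f)

  listSum-++ : (xs ys : List I) (f : I → Carrier) → listSum (xs ++ ys) f ≈ listSum xs f + listSum ys f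
  listSum-++ []       ys f = sym (+-identityˡ _)
  listSum-++ (x ∷ xs) ys f = trans (+-congˡ (listSum-++ xs ys f)) (sym (+-assoc _ _ _))

  *-distribˡ-listSum : ∀ x (xs : List I) f → x * listSum xs f ≈ listSum xs (λ y → x * f y)
  *-distribˡ-listSum x []       f = zeroʳ x
  *-distribˡ-listSum x (y ∷ xs) f = trans (distribˡ _ _ _) (+-congˡ (*-distribˡ-listSum x xs f))

  *-distribʳ-listSum : ∀ x (xs : List I) f → listSum xs f * x ≈ listSum xs (λ y → f y * x)
  *-distribʳ-listSum x []       f = zeroˡ x
  *-distribʳ-listSum x (y ∷ xs) f = trans (distribʳ _ _ _) (+-congˡ (*-distribʳ-listSum x xs f))

  listSum-zero : (xs : List I) → listSum xs (λ _ → 0#) ≈ 0#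
  listSum-zero []       = refl
  listSum-zero (x ∷ xs) = trans (+-identityˡ _) (listSum-zero xs)

  listSum-+ : (xs : List I) (f g : I → Carrier) → listSum xs (λ x → f x + g x) ≈ listSum xs f + listSum xs g
  listSum-+ []       f g = sym (+-identityˡ _)
  listSum-+ (x ∷ xs) f g = begin
    f x + g x + listSum xs (λ x → f x + g x)   ≈⟨ +-congˡ (listSum-+ xs f g) ⟩
    f x + g x + (listSum xs f + listSum xs g)  ≈⟨ +-assoc _ _ _ ⟩
    f x + (g x + (listSum xs f + listSum xs g)) ≈⟨ +-congˡ (+-assoc _ _ _) ⟨
    f x + (g x + listSum xs f + listSum xs g)  ≈⟨ +-congˡ (+-congʳ (+-comm _ _)) ⟩
    f x + (listSum xs f + g x + listSum xs g)  ≈⟨ +-congˡ (+-assoc _ _ _) ⟩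
    f x + (listSum xs f + (g x + listSum xs g)) ≈⟨ +-assoc _ _ _ ⟨
    f x + listSum xs f + (g x + listSum xs g)  ∎

  listSum-comm : (xs : List I) (ys : List J) (f : I → J → Carrier) →
    listSum xs (λ x → listSum ys (f x)) ≈ listSum ys (λ y → listSum xs (λ x → f x y))
  listSum-comm []       ys f = sym (listSum-zero ys)
  listSum-comm (x ∷ xs) ys f = trans (+-congˡ (listSum-comm xs ys f)) (sym (listSum-+ ys (f x) _))

  listSum-cartesianProductWith : ∀ {Z : Set} (h : I → J → Z) xs ys (f : Z → Carrier) →
    listSum (cartesianProductWith h xs ys) f ≈ listSum xs (λ x → listSum ys (λ y → f (h x y)))
  listSum-cartesianProductWith h []       ys f = refl
  listSum-cartesianProductWith h (x ∷ xs) ys f = trans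
    (listSum-++ (map (h x) ys) _ f)
    (+-cong (reflexive (listSum-map (h x) ys f)) (listSum-cartesianProductWith h xs ys f))

  product-cong : {f g : Fin q → Carrier} → (∀ k → f k ≈ g k) → product f ≈ product g
  product-cong {zero}  f≈g = refl
  product-cong {suc q} f≈g = *-cong (f≈g zero) (product-cong (f≈g ∘ suc))

  Central : Carrier → Set (c ⊔ ℓ)
  Central x = ∀ y → x * y ≈ y * x

  1#-central : Central 1#
  1#-central y = trans (*-identityˡ y) (sym (*-identityʳ y))

  *-central : ∀ {x y} → Central x → Central y → Central (x * y)
  *-central {x} {y} x-central y-central z = begin
    x * y * z   ≈⟨ *-assoc _ _ _ ⟩
    x * (y * z) ≈⟨ *-congˡ (y-central z) ⟩
    x * (z * y) ≈⟨ *-assoc _ _ _ ⟨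
    x * z * y   ≈⟨ *-congʳ (x-central z) ⟩
    z * x * y   ≈⟨ *-assoc _ _ _ ⟩
    z * (x * y) ∎

  weight : (Fin q → Carrier) → List (Fin q) → Carrier
  weight a = foldr (λ g → a g *_) 1#

  weight-central : (a : Fin q → Carrier) → (∀ k → Central (a k)) → ∀ gs → Central (weight a gs)
  weight-central a a-central []       = 1#-central
  weight-central a a-central (g ∷ gs) = *-central (a-central g) (weight-central a a-central gs)

  weight-map-suc : (a : Fin (suc q) → Carrier) (gs : List (Fin q)) → weight a (map suc gs) ≡ weight (a ∘ suc) gs
  weight-map-suc a []       = ≡.refl
  weight-map-suc a (g ∷ gs) = cong (a (suc g) *_) (weight-map-suc a gs)

  -- X k s is the k-th matrix, acting in the s-th tensor factor.
  record Covariant (q : ℕ) : Set (c ⊔ ℓ) where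
    field
      op      : Permutation′ q → Carrier
      op-cong : ∀ π ρ → π Perm.≈ ρ → op π ≈ op ρ
      op-id   : op Perm.id ≈ 1#
      op-∘    : ∀ π ρ → op π * op ρ ≈ op (ρ ∘ₚ π)
      X       : Fin q → Fin q → Carrier
      op-X    : ∀ π k s → op π * X k s ≈ X k (π ⟨$⟩ʳ s) * op π

    -- The factor Bₖ Πₖ, with `a k` standing for the coefficient including its sign.
    fused : (Fin q → Carrier) → Fin q → Carrier
    fused a k = X k k * (1# + a k * listSum (filter (k Fin.<?_) (allFin q)) (λ i → op (transpose k i)))

    -- The summand of σ in the final formula, for any words, so that it can also be formed for τ
    -- from the shrunk words of σ.
    term : (Fin q → Carrier) → (σ : Permutation′ q) → List (List (Fin q)) → Carrier
    term a σ ws = weight a (nonMaximaOf ws) * (op (flip σ) * product (λ i → X i (restrictFrom ws i i)))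

  -- The permutations of the last `q` positions act through `lift₀` on the same algebra. The
  -- induction thus stays in one ring instead of passing to a smaller tensor power, which is the
  -- reason for the abstract record.
  tailᶜ : Covariant (suc q) → Covariant q
  tailᶜ C = record
    { op      = op ∘ lift₀
    ; op-cong = λ π ρ π≈ρ → op-cong (lift₀ π) (lift₀ ρ) (lift₀-cong π ρ π≈ρ)
    ; op-id   = trans (op-cong (lift₀ Perm.id) Perm.id lift₀-id) op-id
    ; op-∘    = λ π ρ → trans (op-∘ (lift₀ π) (lift₀ ρ))
                  (op-cong (lift₀ ρ ∘ₚ lift₀ π) (lift₀ (ρ ∘ₚ π)) (lift₀-comp ρ π))
    ; X       = λ k s → X (suc k) (suc s)
    ; op-X    = λ π k s → op-X (lift₀ π) (suc k) (suc s)
    }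
    where open Covariant C

  module Step (C : Covariant (suc q)) (a : Fin (suc q) → Carrier) (a-central : ∀ k → Central (a k)) where
    open Covariant C
    private
      module C′ = Covariant (tailᶜ C)

    β : Fin (suc q) → Carrier
    β zero    = 1#
    β (suc _) = a zero

    β-central : ∀ i → Central (β i)
    β-central zero    = 1#-central
    β-central (suc _) = a-central zero

    -- Writing the summand 1 as the degenerate transposition of `zero` with itself makes the choices
    -- range over all of `allFin (suc q)`, as they do in `permutations`.
    fused-zero : fused a zero ≈ X zero zero * listSum (allFin (suc q)) (λ i → β i * op (transpose zero i))
    fused-zero = *-congˡ (+-cong 1#≈op (begin
      a zero * listSum (filter (zero {q} Fin.<?_) (allFin (suc q))) (λ i → op (transpose zero i))
        ≈⟨ *-congˡ (reflexive (cong (λ is → listSum is (λ i → op (transpose zero i))) (filter-zero<? q))) ⟩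
      a zero * listSum (map suc (allFin q)) (λ i → op (transpose zero i))
        ≈⟨ *-distribˡ-listSum (a zero) (map suc (allFin q)) (λ i → op (transpose zero i)) ⟩
      listSum (map suc (allFin q)) (λ i → a zero * op (transpose zero i))
        ≈⟨ reflexive (listSum-map suc (allFin q) (λ i → a zero * op (transpose zero i))) ⟩
      listSum (allFin q) (λ i → β (suc i) * op (transpose zero (suc i)))
        ≈⟨ reflexive (listSum-map suc (allFin q) (λ i → β i * op (transpose zero i))) ⟨
      listSum (map suc (allFin q)) (λ i → β i * op (transpose zero i))
        ≈⟨ reflexive (cong (λ is → listSum is (λ i → β i * op (transpose zero i))) (map-tabulate id suc)) ⟩
      listSum (tabulate suc) (λ i → β i * op (transpose zero i)) ∎))
      where
      transpose-zero-zero : transpose (zero {q}) zero Perm.≈ Perm.id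
      transpose-zero-zero zero    = ≡.refl
      transpose-zero-zero (suc k) = ≡.refl
      1#≈op : 1# ≈ 1# * op (transpose zero zero)
      1#≈op = sym (trans (*-identityˡ _) (trans (op-cong _ Perm.id transpose-zero-zero) op-id))

    fused-suc : ∀ k → fused a (suc k) ≈ C′.fused (a ∘ suc) k
    fused-suc k = *-congˡ (+-congˡ (*-congˡ (begin
      listSum (filter (suc k Fin.<?_) (allFin (suc q))) (λ i → op (transpose (suc k) i))
        ≈⟨ reflexive (cong (λ is → listSum is (λ i → op (transpose (suc k) i))) (filter-suc<? k)) ⟩
      listSum (map suc (filter (k Fin.<?_) (allFin q))) (λ i → op (transpose (suc k) i))
        ≈⟨ reflexive (listSum-map suc (filter (k Fin.<?_) (allFin q)) _) ⟩
      listSum (filter (k Fin.<?_) (allFin q)) (λ i → op (transpose (suc k) (suc i)))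
        ≈⟨ listSum-cong (filter (k Fin.<?_) (allFin q)) (λ i → op-cong _ (lift₀ (transpose k i)) (lift₀-transpose k i)) ⟩
      listSum (filter (k Fin.<?_) (allFin q)) (λ i → op (lift₀ (transpose k i))) ∎)))

    -- A choice `i` carries the factor `a zero` exactly when σ moves `zero`, since σ sends `zero` to
    -- the image of `i` under `lift₀ τ`.
    β-weight : ∀ (τ : Permutation′ q) i (d : CycleWords (transpose zero i ∘ₚ lift₀ τ)) → let open CycleWords d in
               β i * weight (a ∘ suc) (nonMaximaOf (map shrink words)) ≈ weight a (nonMaximaOf words)
    β-weight τ zero    d = trans (*-identityˡ _) (sym (reflexive (≡.trans
      (cong (weight a) (nonMaxima-fixed words (once-zero {ws = words} disjoint) (correct zero)))
      (weight-map-suc a (nonMaximaOf (map shrink words))))))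
      where open CycleWords d
    β-weight τ (suc i) d = sym (reflexive (≡.trans
      (cong (weight a) (nonMaxima-moved words (once-zero {ws = words} disjoint) moved))
      (cong (a zero *_) (weight-map-suc a (nonMaximaOf (map shrink words))))))
      where
      open CycleWords d
      moved : ⟦ words ⟧ zero ≢ zero
      moved eq with () ← ≡.trans (≡.sym (correct zero)) eq

    -- The central factors are collected in front. Then the transposition merges with τ⁻¹ into σ⁻¹,
    -- and the matrix for `zero` is moved across σ⁻¹; the later matrices already stand to the right
    -- of it and keep their positions.
    term-suc : ∀ (τ : Permutation′ q) i (d : CycleWords (transpose zero i ∘ₚ lift₀ τ)) → let open CycleWords d in
               X zero zero * (β i * op (transpose zero i)) * C′.term (a ∘ suc) τ (map shrink words) ≈
               term a (transpose zero i ∘ₚ lift₀ τ) words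
    term-suc τ i d = begin
      X zero zero * (β i * op t) * (w′ * (op (lift₀ (flip τ)) * Z′))
        ≈⟨ *-congʳ (trans (sym (*-assoc _ _ _)) (trans (*-congʳ (sym (β-central i _))) (*-assoc _ _ _))) ⟩
      β i * (X zero zero * op t) * (w′ * (op (lift₀ (flip τ)) * Z′))
        ≈⟨ *-assoc _ _ _ ⟩
      β i * (X zero zero * op t * (w′ * (op (lift₀ (flip τ)) * Z′)))
        ≈⟨ *-congˡ (trans (sym (*-assoc _ _ _)) (trans (*-congʳ (sym (w′-central _))) (*-assoc _ _ _))) ⟩
      β i * (w′ * (X zero zero * op t * (op (lift₀ (flip τ)) * Z′)))
        ≈⟨ *-assoc _ _ _ ⟨
      β i * w′ * (X zero zero * op t * (op (lift₀ (flip τ)) * Z′))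
        ≈⟨ *-cong (β-weight τ i d) (begin
          X zero zero * op t * (op (lift₀ (flip τ)) * Z′)   ≈⟨ *-assoc _ _ _ ⟩
          X zero zero * (op t * (op (lift₀ (flip τ)) * Z′)) ≈⟨ *-congˡ (*-assoc _ _ _) ⟨
          X zero zero * (op t * op (lift₀ (flip τ)) * Z′)
            ≈⟨ *-congˡ (*-congʳ (trans (op-∘ t (lift₀ (flip τ))) (op-cong _ (flip σ) flip-σ))) ⟩
          X zero zero * (op (flip σ) * Z′)                  ≈⟨ *-assoc _ _ _ ⟨
          X zero zero * op (flip σ) * Z′                    ≈⟨ *-congʳ X-op ⟩
          op (flip σ) * X zero (restrictFrom words zero zero) * Z′ ≈⟨ *-assoc _ _ _ ⟩
          op (flip σ) * (X zero (restrictFrom words zero zero) * Z′)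
            ≈⟨ *-congˡ (*-congˡ (product-cong {q} λ k → reflexive (cong (X (suc k)) (restrictFrom-suc words k)))) ⟨
          op (flip σ) * product (λ k → X k (restrictFrom words k k)) ∎) ⟩
      term a σ words ∎
      where
      open CycleWords d
      t = transpose zero i
      σ = t ∘ₚ lift₀ τ
      w′ = weight (a ∘ suc) (nonMaximaOf (map shrink words))
      w′-central : Central w′
      w′-central = weight-central (a ∘ suc) (a-central ∘ suc) (nonMaximaOf (map shrink words))
      Z′ = product (λ k → X (suc k) (suc (restrictFrom (map shrink words) k k)))
      -- This is (0 i) τ⁻¹ = (τ (0 i))⁻¹; `_∘ₚ_` applies its left argument first.
      flip-σ : lift₀ (flip τ) ∘ₚ t Perm.≈ flip σ
      flip-σ zero    = ≡.sym (transpose-zero-comm i zero)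
      flip-σ (suc k) = ≡.sym (transpose-zero-comm i (suc (τ ⟨$⟩ˡ k)))
      X-op : X zero zero * op (flip σ) ≈ op (flip σ) * X zero (restrictFrom words zero zero)
      X-op = begin
        -- Position `zero` is rewritten as the image of σ(0) under σ⁻¹, so that `op-X` applies from
        -- right to left.
        X zero zero * op (flip σ) ≈⟨ *-congʳ (reflexive (cong (X zero) (inverseˡ σ))) ⟨
        X zero (flip σ ⟨$⟩ʳ (σ ⟨$⟩ʳ zero)) * op (flip σ) ≈⟨ op-X (flip σ) zero (σ ⟨$⟩ʳ zero) ⟨
        op (flip σ) * X zero (σ ⟨$⟩ʳ zero)
          ≈⟨ *-congˡ (reflexive (cong (X zero) (≡.trans (restrictFrom-zero words) (correct zero)))) ⟨
        op (flip σ) * X zero (restrictFrom words zero zero) ∎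

  -- The family `cycles` is quantified inside the induction, so that shrunk words can be supplied to
  -- the hypothesis.
  expansion : (C : Covariant q) (a : Fin q → Carrier) → (∀ k → Central (a k)) →
              (cycles : ∀ σ → CycleWords σ) → let open Covariant C in
              product (fused a) ≈ listSum (permutations q) (λ σ → term a σ (CycleWords.words (cycles σ)))
  expansion {zero}  C a a-central cycles = sym (begin
    term + 0#                       ≈⟨ +-identityʳ _ ⟩
    weight a (nonMaximaOf (CycleWords.words (cycles Perm.id))) * (op (flip Perm.id) * 1#)
      ≈⟨ *-cong (reflexive (cong (weight a) (no-indices (nonMaximaOf (CycleWords.words (cycles Perm.id))))))
                (trans (*-identityʳ _) (trans (op-cong _ Perm.id (λ ())) op-id)) ⟩
    1# * 1#                          ≈⟨ *-identityˡ 1# ⟩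
    1#                               ∎)
    where
    open Covariant C hiding (term)
    term = Covariant.term C a Perm.id (CycleWords.words (cycles Perm.id))
    no-indices : (gs : List (Fin 0)) → gs ≡ []
    no-indices [] = ≡.refl
  expansion {suc q} C a a-central cycles = begin
    fused a zero * product (fused a ∘ suc)
      ≈⟨ *-cong fused-zero (product-cong {q} fused-suc) ⟩
    X zero zero * listSum (allFin (suc q)) f * P
      ≈⟨ *-congʳ (*-distribˡ-listSum (X zero zero) (allFin (suc q)) f) ⟩
    listSum (allFin (suc q)) (λ i → X zero zero * f i) * P
      ≈⟨ *-distribʳ-listSum P (allFin (suc q)) _ ⟩
    listSum (allFin (suc q)) (λ i → X zero zero * f i * P)
      ≈⟨ listSum-cong (allFin (suc q)) (λ i → trans
           (*-congˡ (expansion (tailᶜ C) (a ∘ suc) (a-central ∘ suc) (λ τ → shrinkWords {τ = τ} (d i τ))))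
           (trans (*-distribˡ-listSum _ (permutations q) _)
             (listSum-cong (permutations q) (λ τ → term-suc τ i (d i τ))))) ⟩
    listSum (allFin (suc q)) (λ i → listSum (permutations q) (λ τ → T (transpose zero i ∘ₚ lift₀ τ)))
      -- The expansion produces `i` as the outer index, whereas `permutations` enumerates τ outside
      -- and `i` inside.
      ≈⟨ listSum-comm (allFin (suc q)) (permutations q) (λ i τ → T (transpose zero i ∘ₚ lift₀ τ)) ⟩
    listSum (permutations q) (λ τ → listSum (allFin (suc q)) (λ i → T (transpose zero i ∘ₚ lift₀ τ)))
      ≈⟨ listSum-cartesianProductWith (λ τ i → transpose zero i ∘ₚ lift₀ τ) (permutations q) (allFin (suc q)) T ⟨
    listSum (permutations (suc q)) T ∎
    where
    open Covariant C
    open Step C a a-central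
    module C′ = Covariant (tailᶜ C)
    -- The words for τ depend on i, so there is one induction hypothesis for
    -- each i.
    d : ∀ i τ → CycleWords (transpose zero i ∘ₚ lift₀ τ)
    d i τ = cycles (transpose zero i ∘ₚ lift₀ τ)
    T : Permutation′ (suc q) → Carrier
    T σ = term a σ (CycleWords.words (cycles σ))
    f : Fin (suc q) → Carrier
    f i = β i * op (transpose zero i)
    P = product (C′.fused (a ∘ suc))

-- Series and matrices over a ring

module _ {c ℓ} (R : Ring c ℓ) where
  open Ring R hiding (zero)
  open Sum semiring
  private module S = RawRing (Series rawRing)

  series-*-cong : ∀ {f f′ g g′ : ℕ → Carrier} → f S.≈ f′ → g S.≈ g′ → f S.* g S.≈ f′ S.* g′
  series-*-cong f≈ g≈ r = sum-cong-≋ {suc r} λ i → *-cong (f≈ (toℕ i)) (g≈ (r ∸ toℕ i))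

  series-distribˡ : ∀ f g h → f S.* (g S.+ h) S.≈ (f S.* g) S.+ (f S.* h)
  series-distribˡ f g h r = trans
    (sum-cong-≋ {suc r} λ i → distribˡ (f (toℕ i)) (g (r ∸ toℕ i)) (h (r ∸ toℕ i)))
    (∑-distrib-+ {suc r} (λ i → f (toℕ i) * g (r ∸ toℕ i)) (λ i → f (toℕ i) * h (r ∸ toℕ i)))

  series-distribʳ : ∀ f g h → (g S.+ h) S.* f S.≈ (g S.* f) S.+ (h S.* f)
  series-distribʳ f g h r = trans
    (sum-cong-≋ {suc r} λ i → distribʳ (f (r ∸ toℕ i)) (g (toℕ i)) (h (toℕ i)))
    (∑-distrib-+ {suc r} (λ i → g (toℕ i) * f (r ∸ toℕ i)) (λ i → h (toℕ i) * f (r ∸ toℕ i)))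

  series-*-scaleˡ : ∀ x f g r → ((λ i → x * f i) S.* g) r ≈ x * (f S.* g) r
  series-*-scaleˡ x f g r = trans
    (sum-cong-≋ {suc r} λ i → *-assoc x (f (toℕ i)) (g (r ∸ toℕ i)))
    (sym (*-distribˡ-sum {suc r} x (λ i → f (toℕ i) * g (r ∸ toℕ i))))

  series-*-zeroˡ : ∀ f r → (S.0# S.* f) r ≈ 0#
  series-*-zeroˡ f r = trans (sum-cong-≋ {suc r} λ i → zeroˡ (f (r ∸ toℕ i))) (sum-replicate-zero (suc r))

  -- The product unfolds by computation from the lowest coefficient of its left factor. Exchanging
  -- the factors reverses the order of summation, so `series-*-comm` needs the unfolding from the
  -- other end.
  series-*-last : ∀ f g r → (f S.* g) (suc r) ≈ (f S.* (g ∘ suc)) r + f (suc r) * g 0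
  series-*-last f g zero    =
    trans (+-congˡ (+-identityʳ _)) (+-congʳ (sym (+-identityʳ _)))
  series-*-last f g (suc r) =
    trans (+-congˡ (series-*-last (f ∘ suc) g r)) (sym (+-assoc _ _ _))

  -- The recursion (f g)ᵣ₊₁ = f₀ gᵣ₊₁ + (f′ g)ᵣ, f′ being f shifted, holds by
  -- computation.
  series-*-assoc : ∀ f g h → (f S.* g) S.* h S.≈ f S.* (g S.* h)
  series-*-assoc f g h zero = begin
    (f 0 * g 0 + 0#) * h 0 + 0# ≈⟨ +-congʳ (*-congʳ (+-identityʳ _)) ⟩
    f 0 * g 0 * h 0 + 0#        ≈⟨ +-congʳ (*-assoc _ _ _) ⟩
    f 0 * (g 0 * h 0) + 0#      ≈⟨ +-congʳ (*-congˡ (+-identityʳ _)) ⟨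
    f 0 * (g 0 * h 0 + 0#) + 0# ∎
    where open ≈-Reasoning setoid
  series-*-assoc f g h (suc r) = begin
    (f S.* g) 0 * h (suc r) + (((f S.* g) ∘ suc) S.* h) r
      ≈⟨ +-cong (trans (*-congʳ (+-identityʳ _)) (*-assoc _ _ _))
                (series-distribʳ h (λ i → f 0 * g (suc i)) ((f ∘ suc) S.* g) r) ⟩
    f 0 * (g 0 * h (suc r)) + (((λ i → f 0 * g (suc i)) S.* h) r + (((f ∘ suc) S.* g) S.* h) r)
      ≈⟨ +-congˡ (+-cong (series-*-scaleˡ (f 0) (g ∘ suc) h r) (series-*-assoc (f ∘ suc) g h r)) ⟩
    f 0 * (g 0 * h (suc r)) + (f 0 * ((g ∘ suc) S.* h) r + ((f ∘ suc) S.* (g S.* h)) r)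
      ≈⟨ +-assoc _ _ _ ⟨
    f 0 * (g 0 * h (suc r)) + f 0 * ((g ∘ suc) S.* h) r + ((f ∘ suc) S.* (g S.* h)) r
      ≈⟨ +-congʳ (distribˡ _ _ _) ⟨
    (f S.* (g S.* h)) (suc r) ∎
    where open ≈-Reasoning setoid

  series-*-identityˡ : ∀ f → S.1# S.* f S.≈ f
  series-*-identityˡ f zero    = trans (+-identityʳ _) (*-identityˡ _)
  series-*-identityˡ f (suc r) =
    trans (+-cong (*-identityˡ _) (series-*-zeroˡ f r)) (+-identityʳ _)

  series-*-comm : ∀ f g → (∀ i → Central semiring (f i)) → f S.* g S.≈ g S.* f
  series-*-comm f g central zero    = +-congʳ (central 0 (g 0))
  series-*-comm f g central (suc r) = begin
    f 0 * g (suc r) + ((f ∘ suc) S.* g) r ≈⟨ +-comm _ _ ⟩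
    ((f ∘ suc) S.* g) r + f 0 * g (suc r)
      ≈⟨ +-cong (series-*-comm (f ∘ suc) g (central ∘ suc) r) (central 0 _) ⟩
    (g S.* (f ∘ suc)) r + g (suc r) * f 0 ≈⟨ series-*-last g f r ⟨
    (g S.* f) (suc r)                     ∎
    where open ≈-Reasoning setoid

  series-1#-central : ∀ i → Central semiring (S.1# i)
  series-1#-central zero    x = 1#-central semiring x
  series-1#-central (suc i) x = trans (zeroˡ x) (sym (zeroʳ x))

  seriesRing : Ring c ℓ
  seriesRing = record
    { isRing = record
      { +-isAbelianGroup = Pointwise.isAbelianGroup ℕ +-isAbelianGroup
      ; *-cong           = series-*-cong
      ; *-assoc          = series-*-assoc
      ; *-identity       = series-*-identityˡ , λ f r →
          trans (sym (series-*-comm S.1# f series-1#-central r)) (series-*-identityˡ f r)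
      ; distrib          = series-distribˡ , series-distribʳ
      }
    }

does-≟-comm : (i j : Fin n) → does (i ≟ j) ≡ does (j ≟ i)
does-≟-comm i j = does-⇔ (mk⇔ ≡.sym ≡.sym) (i ≟ j) (j ≟ i)

module _ {c ℓ} (R : Ring c ℓ) where
  open Ring R hiding (zero)
  open Sum semiring
  open Tensor rawRing

  sum-δ-* : (i : Fin n) (f : Fin n → Carrier) →
            (sum λ k → (if does (i ≟ k) then 1# else 0#) * f k) ≈ f i
  sum-δ-* {suc n} zero f = trans
    (+-cong (*-identityˡ _) (trans (sum-cong-≋ {n} λ k → zeroˡ (f (suc k))) (sum-replicate-zero n)))
    (+-identityʳ _)
  sum-δ-* (suc i) f = trans (+-cong (zeroˡ _) (sum-δ-* i (f ∘ suc))) (+-identityˡ _)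

  sum-*-δ : (i : Fin n) (f : Fin n → Carrier) →
            (sum λ k → f k * (if does (k ≟ i) then 1# else 0#)) ≈ f i
  sum-*-δ {n} i f = trans (sum-cong-≋ {n} commute) (sum-δ-* i f)
    where
    commute : ∀ k → f k * (if does (k ≟ i) then 1# else 0#) ≈ (if does (i ≟ k) then 1# else 0#) * f k
    commute k rewrite does-≟-comm k i with does (i ≟ k)
    ... | true  = trans (*-identityʳ _) (sym (*-identityˡ _))
    ... | false = trans (zeroʳ _) (sym (zeroˡ _))

  matrixRing : ℕ → Ring c ℓ
  matrixRing N = record
    { isRing = record
      { +-isAbelianGroup =
          Pointwise.isAbelianGroup (Fin N) (Pointwise.isAbelianGroup (Fin N) +-isAbelianGroup)
      ; *-cong     = λ X≈ Y≈ i j → sum-cong-≋ {N} λ k → *-cong (X≈ i k) (Y≈ k j)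
      ; *-assoc    = M-assoc
      ; *-identity = (λ X i j → sum-δ-* i (λ k → X k j)) , λ X i j → sum-*-δ j (X i)
      ; distrib    =
          (λ X Y Z i j → trans
            (sum-cong-≋ {N} λ k → distribˡ (X i k) (Y k j) (Z k j))
            (∑-distrib-+ {N} (λ k → X i k * Y k j) (λ k → X i k * Z k j)))
        , (λ X Y Z i j → trans
            (sum-cong-≋ {N} λ k → distribʳ (X k j) (Y i k) (Z i k))
            (∑-distrib-+ {N} (λ k → Y i k * X k j) (λ k → Z i k * X k j)))
      }
    }
    where
    module M = RawRing (Matrix N)
    M-assoc : ∀ X Y Z → (X M.* Y) M.* Z M.≈ X M.* (Y M.* Z)
    M-assoc X Y Z i j = begin
      (sum λ k → (sum λ h → X i h * Y h k) * Z k j)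
        ≈⟨ (sum-cong-≋ {N} λ k → trans (*-distribʳ-sum {N} (Z k j) _) (sum-cong-≋ {N} λ h → *-assoc _ _ _)) ⟩
      (sum λ k → sum λ h → X i h * (Y h k * Z k j))
        ≈⟨ ∑-comm {N} {N} _ ⟩
      (sum λ h → sum λ k → X i h * (Y h k * Z k j))
        ≈⟨ (sum-cong-≋ {N} λ h → *-distribˡ-sum {N} (X i h) _) ⟨
      (sum λ h → X i h * (sum λ k → Y h k * Z k j)) ∎
      where open ≈-Reasoning setoid

-- Permutation operators on tensor powers

funToFin-cong : {f g : Fin p → Fin n} → f ≗ g → funToFin f ≡ funToFin g
funToFin-cong {zero}  f≗g = ≡.refl
funToFin-cong {suc p} f≗g = cong₂ combine (f≗g zero) (funToFin-cong (f≗g ∘ suc))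

⟨$⟩ˡ-cong : (π ρ : Permutation′ n) → π Perm.≈ ρ → ∀ i → π ⟨$⟩ˡ i ≡ ρ ⟨$⟩ˡ i
⟨$⟩ˡ-cong π ρ π≈ρ i = begin
  π ⟨$⟩ˡ i                       ≡⟨ inverseˡ ρ ⟨
  ρ ⟨$⟩ˡ (ρ ⟨$⟩ʳ (π ⟨$⟩ˡ i))     ≡⟨ cong (ρ ⟨$⟩ˡ_) (π≈ρ (π ⟨$⟩ˡ i)) ⟨
  ρ ⟨$⟩ˡ (π ⟨$⟩ʳ (π ⟨$⟩ˡ i))     ≡⟨ cong (ρ ⟨$⟩ˡ_) (inverseʳ π) ⟩
  ρ ⟨$⟩ˡ i                       ∎
  where open ≡.≡-Reasoning

-- The index of the basis vector to which `operator π` sends the basis vector with index `J`.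
act : Permutation′ p → Fin (n ^ p) → Fin (n ^ p)
act {p} {n} π J = funToFin (λ t → finToFun {n} {p} J (π ⟨$⟩ˡ t))

act-cong : (π ρ : Permutation′ p) → π Perm.≈ ρ → (J : Fin (n ^ p)) → act π J ≡ act ρ J
act-cong {p} {n} π ρ π≈ρ J = funToFin-cong λ t → cong (finToFun {n} {p} J) (⟨$⟩ˡ-cong π ρ π≈ρ t)

act-id : (J : Fin (n ^ p)) → act {p} {n} Perm.id J ≡ J
act-id {n} {p} J = funToFin-finToFin {p} {n} J

act-∘ : (π ρ : Permutation′ p) (J : Fin (n ^ p)) → act π (act ρ J) ≡ act (ρ ∘ₚ π) J
act-∘ {p} {n} π ρ J = funToFin-cong λ t →
  finToFun-funToFin (λ t → finToFun {n} {p} J (ρ ⟨$⟩ˡ t)) (π ⟨$⟩ˡ t)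

act-inverseˡ : (π : Permutation′ p) (J : Fin (n ^ p)) → act (flip π) (act π J) ≡ J
act-inverseˡ {p} {n} π J = ≡.trans (act-∘ (flip π) π J)
  (≡.trans (act-cong {n = n} (π ∘ₚ flip π) Perm.id (λ _ → inverseˡ π) J) (act-id {n} {p} J))

act-inverseʳ : (π : Permutation′ p) (J : Fin (n ^ p)) → act π (act (flip π) J) ≡ J
act-inverseʳ {p} {n} π J = ≡.trans (act-∘ π (flip π) J)
  (≡.trans (act-cong {n = n} (flip π ∘ₚ π) Perm.id (λ _ → inverseʳ π) J) (act-id {n} {p} J))

module _ {c ℓ} (R : Ring c ℓ) where
  open Ring R hiding (zero)
  open Sum semiring
  open Tensor rawRing
  private module M {N} = Ring (matrixRing R N)
  open RawSemiringDefinitions (RawRing.rawSemiring rawRing) using (product)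

  *-operator : (π : Permutation′ p) (X : Mat (n ^ p)) →
               X M.* operator {n = n} π M.≈ λ I J → X I (act π J)
  *-operator π X I J = sum-*-δ R (act π J) (X I)

  operator-* : (π : Permutation′ p) (X : Mat (n ^ p)) →
               operator {n = n} π M.* X M.≈ λ I J → X (act (flip π) I) J
  operator-* {p} {n} π X I J = trans
    (sum-cong-≋ {n ^ p} λ K → *-congʳ (reflexive (cong (λ b → if b then 1# else 0#) (adjoint K))))
    (sum-δ-* R (act (flip π) I) (λ K → X K J))
    where
    adjoint : ∀ K → does (I ≟ act π K) ≡ does (act (flip π) I ≟ K)
    adjoint K = does-⇔
      (mk⇔ (λ { ≡.refl → act-inverseˡ {n = n} π K }) (λ { ≡.refl → ≡.sym (act-inverseʳ {n = n} π I) }))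
      (I ≟ act π K) (act (flip π) I ≟ K)

  operator-cong : (π ρ : Permutation′ p) → π Perm.≈ ρ → operator {n = n} π M.≈ operator ρ
  operator-cong π ρ π≈ρ I J =
    reflexive (cong (λ K → if does (I ≟ K) then 1# else 0#) (act-cong π ρ π≈ρ J))

  operator-id : operator {p} {n} Perm.id M.≈ M.1#
  operator-id {p} {n} I J =
    reflexive (cong (λ K → if does (I ≟ K) then 1# else 0#) (act-id {n} {p} J))

  operator-∘ : (π ρ : Permutation′ p) →
               operator {n = n} π M.* operator ρ M.≈ operator (ρ ∘ₚ π)
  operator-∘ π ρ I J = trans (*-operator ρ (operator π) I J)
    (reflexive (cong (λ K → if does (I ≟ K) then 1# else 0#) (act-∘ {n = _} π ρ J)))

  indicator : Bool → Carrier
  indicator b = if b then 1# else 0#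

  product-indicator-true : (b : Fin p → Bool) → (∀ t → b t ≡ true) → product (indicator ∘ b) ≈ 1#
  product-indicator-true {zero}  b b≡ = refl
  product-indicator-true {suc p} b b≡ = trans
    (*-cong (reflexive (cong indicator (b≡ zero))) (product-indicator-true (b ∘ suc) (b≡ ∘ suc)))
    (*-identityˡ 1#)

  product-indicator-false : (b : Fin p → Bool) → ∀ t → b t ≡ false → product (indicator ∘ b) ≈ 0#
  product-indicator-false b zero    b≡ = trans (*-congʳ (reflexive (cong indicator b≡))) (zeroˡ _)
  product-indicator-false b (suc t) b≡ =
    trans (*-congˡ (product-indicator-false (b ∘ suc) t b≡)) (zeroʳ _)

  -- The ring is not commutative, so products cannot be reordered in general. With factors 0 and 1
  -- the product is 1 if all factors are 1 and 0 otherwise, whatever their order.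
  product-indicator-permute : (π : Permutation′ p) (b : Fin p → Bool) →
    product (indicator ∘ b) ≈ product (λ t → indicator (b (π ⟨$⟩ʳ t)))
  product-indicator-permute π b with all? (λ t → b t Bool.≟ true)
  ... | yes all-true = trans (product-indicator-true b all-true)
    (sym (product-indicator-true (λ t → b (π ⟨$⟩ʳ t)) (all-true ∘ (π ⟨$⟩ʳ_))))
  ... | no ¬all-true with ¬∀⟶∃¬ _ (λ t → b t ≡ true) (λ t → b t Bool.≟ true) ¬all-true
  ...   | t , bt≢true = trans (product-indicator-false b t (¬-not bt≢true))
    (sym (product-indicator-false (λ t → b (π ⟨$⟩ʳ t)) (π ⟨$⟩ˡ t)
      (≡.trans (cong b (inverseʳ π)) (¬-not bt≢true))))

  private
    entry : Bool → (i j a b : Fin n) → Bool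
    entry s i j a b = if s then does (i ≟ a) ∧ does (j ≟ b) else does (a ≟ b)

    entry-correct : ∀ s (i j a b : Fin n) →
      (if s then E i j else M.1#) a b ≡ indicator (entry s i j a b)
    entry-correct true  i j a b with does (i ≟ a)
    ... | true  = ≡.refl
    ... | false = ≡.refl
    entry-correct false i j a b = ≡.refl

    does-≟-permute : (π : Permutation′ p) (s t : Fin p) → does (t ≟ s) ≡ does ((π ⟨$⟩ʳ t) ≟ (π ⟨$⟩ʳ s))
    does-≟-permute π s t = does-⇔
      (mk⇔ (cong (π ⟨$⟩ʳ_)) λ eq → ≡.trans (≡.sym (inverseˡ π)) (≡.trans (cong (π ⟨$⟩ˡ_) eq) (inverseˡ π)))
      (t ≟ s) ((π ⟨$⟩ʳ t) ≟ (π ⟨$⟩ʳ s))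

  -- Permuting the rows on one side and the columns on the other leaves the same tensor factors,
  -- renumbered by π; their entries are 0 or 1, so `product-indicator-permute` applies.
  operator-slot : (π : Permutation′ p) (s : Fin p) (X : Mat n) →
                  operator π M.* slot s X M.≈ slot (π ⟨$⟩ʳ s) X M.* operator π
  operator-slot {p} {n} π s X I J = begin
    (operator π M.* slot s X) I J        ≈⟨ operator-* π (slot s X) I J ⟩
    slot s X (act (flip π) I) J
      ≈⟨ (sum-cong-≋ {n} λ i → sum-cong-≋ {n} λ j → *-congʳ (⨂-permute i j)) ⟩
    slot (π ⟨$⟩ʳ s) X I (act π J)        ≈⟨ *-operator π (slot (π ⟨$⟩ʳ s) X) I J ⟨
    (slot (π ⟨$⟩ʳ s) X M.* operator π) I J ∎
    where
    open ≈-Reasoning setoid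
    moved : Fin n → Fin n → Fin p → Bool
    moved i j t = entry (does (t ≟ (π ⟨$⟩ʳ s))) i j (finToFun {n} {p} I t) (finToFun {n} {p} (act π J) t)
    original : Fin n → Fin n → Fin p → Bool
    original i j t = entry (does (t ≟ s)) i j (finToFun {n} {p} (act (flip π) I) t) (finToFun {n} {p} J t)
    -- At position π(t) the multi-indices on the right are those seen at position t on the left.
    agree : ∀ i j t → original i j t ≡ moved i j (π ⟨$⟩ʳ t)
    agree i j t
      rewrite does-≟-permute π s t
            | finToFun-funToFin (λ t → finToFun {n} {p} I (π ⟨$⟩ʳ t)) t
            | finToFun-funToFin (λ t → finToFun {n} {p} J (π ⟨$⟩ˡ t)) (π ⟨$⟩ʳ t)
            | inverseˡ π {t} = ≡.refl
    ⨂-permute : ∀ i j →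
      ⨂ (λ t → if does (t ≟ s) then E i j else M.1#) (act (flip π) I) J ≈
      ⨂ (λ t → if does (t ≟ (π ⟨$⟩ʳ s)) then E i j else M.1#) I (act π J)
    ⨂-permute i j = begin
      ⨂ (λ t → if does (t ≟ s) then E i j else M.1#) (act (flip π) I) J
        ≈⟨ (product-cong semiring λ t → reflexive
             (≡.trans (entry-correct (does (t ≟ s)) i j _ _) (cong indicator (agree i j t)))) ⟩
      product (λ t → indicator (moved i j (π ⟨$⟩ʳ t)))
        ≈⟨ product-indicator-permute π (moved i j) ⟨
      product (indicator ∘ moved i j)
        ≈⟨ (product-cong semiring λ t → reflexive (entry-correct (does (t ≟ (π ⟨$⟩ʳ s))) i j _ _)) ⟨
      ⨂ (λ t → if does (t ≟ (π ⟨$⟩ʳ s)) then E i j else M.1#) I (act π J) ∎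

-- Scalar matrices and the expansion of inverse linear forms

module _ {c ℓ} (R : Ring c ℓ) {N : ℕ} where
  open Ring R hiding (zero)
  open Sum semiring
  open Tensor rawRing
  private module M = Ring (matrixRing R N)

  ∙1-* : ∀ x (X : Mat N) → (x ∙ M.1#) M.* X M.≈ x ∙ X
  ∙1-* x X i j = begin
    (sum λ k → x * M.1# i k * X k j)   ≈⟨ (sum-cong-≋ {N} λ k → *-assoc x (M.1# i k) (X k j)) ⟩
    (sum λ k → x * (M.1# i k * X k j)) ≈⟨ *-distribˡ-sum {N} x (λ k → M.1# i k * X k j) ⟨
    x * (M.1# M.* X) i j               ≈⟨ *-congˡ (M.*-identityˡ X i j) ⟩
    x * X i j                          ∎
    where open ≈-Reasoning setoid

  *-∙1 : ∀ {x} → Central semiring x → (X : Mat N) → X M.* (x ∙ M.1#) M.≈ x ∙ X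
  *-∙1 {x} x-central X i j = begin
    (sum λ k → X i k * (x * M.1# k j))
      ≈⟨ (sum-cong-≋ {N} λ k → trans (sym (*-assoc (X i k) x (M.1# k j)))
           (trans (*-congʳ (sym (x-central (X i k)))) (*-assoc x (X i k) (M.1# k j)))) ⟩
    (sum λ k → x * (X i k * M.1# k j)) ≈⟨ *-distribˡ-sum {N} x (λ k → X i k * M.1# k j) ⟨
    x * (X M.* M.1#) i j               ≈⟨ *-congˡ (M.*-identityʳ X i j) ⟩
    x * X i j                          ∎
    where open ≈-Reasoning setoid

  ∙1-central : ∀ {x} → Central semiring x → Central M.semiring (x ∙ M.1#)
  ∙1-central {x} x-central X = M.trans (∙1-* x X) (M.sym (*-∙1 x-central X))

module _ {c ℓ₁ ℓ₂} (K : HeytingField c ℓ₁ ℓ₂) (K₀ : CharacteristicZero K) where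
  open Scalars K K₀
  private
    module K where
      open CommutativeRing (fieldCommutativeRing K) public
      open RingProperties ring public
    open SemiringExp K.semiring using (^-congˡ)

  [u-]⁻¹-cong : ∀ {x y} → x K.≈ y → ∀ r → [u-_]⁻¹ (fieldRawRing K) x r K.≈ [u-_]⁻¹ (fieldRawRing K) y r
  [u-]⁻¹-cong x≈y zero    = K.refl
  [u-]⁻¹-cong x≈y (suc r) = ^-congˡ r x≈y

  -- Both linear forms have the same root, and only the inverse of the leading coefficient changes
  -- sign.
  minus-inverse : ∀ a {b b′} → b′ K.≈ K.- b → ∀ r → [ minus a u+ b′ ]⁻¹ r K.≈ K.- [ a u+ b ]⁻¹ r
  minus-inverse (a , a⁻¹ , _) {b} {b′} b′≈-b r = K.trans
    (K.*-congˡ ([u-]⁻¹-cong (K.-‿cong (K.trans (K.*-congˡ b′≈-b)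
      (K.trans (K.sym (K.-‿distribˡ-* a⁻¹ (K.- b)))
        (K.trans (K.-‿cong (K.sym (K.-‿distribʳ-* a⁻¹ b))) (K.-‿involutive _))))) r))
    (K.sym (K.-‿distribˡ-* a⁻¹ _))

-- Specialization to the reflection algebra

module Expansion {c ℓ₁ ℓ₂} (K : HeytingField c ℓ₁ ℓ₂) (K₀ : CharacteristicZero K) (m l : ℕ) where
  open ReflectionAlgebra K K₀ m l
  open Scalars K K₀
  private
    module K where
      open CommutativeRing (fieldCommutativeRing K) public
      open RingProperties ring public
    module 𝓐 where
      open Ring algebra public
      open RingProperties algebra public
      open Sum semiring public
    module 𝓢 where
      open Ring (seriesRing algebra) public
      open RingProperties (seriesRing algebra) public
    module KS = RawRing (Series (fieldRawRing K))
    module KSum = Sum K.semiring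
    open Presented (fieldRawRing K) Generator Relation using (scalar-cong; scalar-+; scalar-*; scalar-central)

  endRing : Ring _ _
  endRing = matrixRing (seriesRing algebra) (N ^ N)

  private module M = Ring endRing
  open RawSemiringDefinitions (Semiring.rawSemiring M.semiring) using (product)

  scalar-sum : ∀ {q} (f : Fin q → Scalar) → scalar (KSum.sum f) 𝓐.≈ 𝓐.sum (scalar ∘ f)
  scalar-sum {zero}  f = 𝓐.refl
  scalar-sum {suc q} f = 𝓐.trans (scalar-+ _ _) (𝓐.+-congˡ (scalar-sum (f ∘ suc)))

  scalar-neg : ∀ x → scalar (K.- x) 𝓐.≈ 𝓐.- scalar x
  scalar-neg x = 𝓐.+-inverseˡ-unique _ _ (𝓐.trans (𝓐.sym (scalar-+ _ _)) (scalar-cong (K.-‿inverseˡ x)))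

  scalars-* : ∀ f g → scalar ∘ (f KS.* g) 𝓢.≈ (scalar ∘ f) 𝓢.* (scalar ∘ g)
  scalars-* f g r = 𝓐.trans (scalar-sum {suc r} (λ i → f (toℕ i) K.* g (r ∸ toℕ i)))
    (𝓐.sum-cong-≋ {suc r} λ i → scalar-* (f (toℕ i)) (g (r ∸ toℕ i)))

  scalars-1# : scalar ∘ KS.1# 𝓢.≈ 𝓢.1#
  scalars-1# zero    = 𝓐.refl
  scalars-1# (suc r) = 𝓐.refl

  scalars-central : ∀ f → Central 𝓢.semiring (scalar ∘ f)
  scalars-central f g = series-*-comm algebra (scalar ∘ f) g (λ i → scalar-central (f i))

  coefficientOf : Fin N → ℕ → Scalar
  coefficientOf k = [ minus two u+ (fromℕ N K.- fromℕ 2 K.+ fromℕ (index k)) ]⁻¹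

  a : Fin N → M.Carrier
  a k = coefficientOf k · M.1#

  a-central : ∀ k → Central M.semiring (a k)
  a-central k = ∙1-central (seriesRing algebra) (scalars-central (coefficientOf k))

  covariant : Covariant M.semiring N
  covariant = record
    { op      = operator {p = N} {n = N}
    ; op-cong = operator-cong (seriesRing algebra)
    ; op-id   = operator-id (seriesRing algebra) {p = N} {n = N}
    ; op-∘    = operator-∘ (seriesRing algebra)
    ; X       = λ k s → slot s B[u- toℕ k ]
    ; op-X    = λ π k s → operator-slot (seriesRing algebra) π s B[u- toℕ k ]
    }

  open Covariant covariant using (fused)

  later : Fin N → M.Carrier
  later k = listSum M.semiring (filter (k Fin.<?_) (allFin N)) (λ i → P k i)

  -- The minus sign is absorbed by negating the linear form: -(2u - k - n + 2) = n - 2u - 2 + k,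
  -- with k the 1-based index.
  Π≈ : ∀ k → Π k M.≈ M.1# M.+ a k M.* later k
  Π≈ k = M.+-congˡ (M.trans negate (M.sym (∙1-* (seriesRing algebra) (scalar ∘ coefficientOf k) (later k))))
    where
    shift = fromℕ 2 K.- fromℕ (index k) K.- fromℕ N
    constants : fromℕ N K.- fromℕ 2 K.+ fromℕ (index k) K.≈ K.- shift
    constants = begin
      ν K.- t K.+ i               ≈⟨ K.+-assoc _ _ _ ⟩
      ν K.+ (K.- t K.+ i)         ≈⟨ K.+-comm _ _ ⟩
      K.- t K.+ i K.+ ν           ≈⟨ K.+-cong (K.+-congˡ (K.-‿involutive i)) (K.-‿involutive ν) ⟨
      K.- t K.- K.- i K.- K.- ν   ≈⟨ K.+-congʳ (K.-‿+-comm t (K.- i)) ⟩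
      K.- (t K.- i) K.- K.- ν     ≈⟨ K.-‿+-comm (t K.- i) (K.- ν) ⟩
      K.- (t K.- i K.- ν)         ∎
      where
      open ≈-Reasoning K.setoid
      ν = fromℕ N
      t = fromℕ 2
      i = fromℕ (index k)
    negate : M.- ([ two u+ shift ]⁻¹ · later k) M.≈ coefficientOf k · later k
    negate I J = 𝓢.trans (𝓢.-‿distribˡ-* (scalar ∘ [ two u+ shift ]⁻¹) (later k I J))
      (𝓢.*-congʳ λ r → 𝓐.trans (𝓐.sym (scalar-neg _))
        (scalar-cong (K.sym (minus-inverse K K₀ two constants r))))

  -- No index follows the last one, so the sum of transpositions is empty. This allows `interleave`,
  -- which ends without a final Π, to be completed to a product of pairs.
  Π-last : ∀ k → suc (toℕ k) ≡ N → Π k M.≈ M.1#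
  Π-last k k-last = M.trans (Π≈ k) (M.trans
    (M.+-congˡ (M.trans (M.*-congˡ {a k} no-later) (M.zeroʳ (a k)))) (M.+-identityʳ M.1#))
    where
    no-later : later k M.≈ M.0#
    no-later = M.reflexive (cong (λ is → listSum M.semiring is (λ i → P k i))
      (filter-none (k Fin.<?_) {xs = allFin N} (All.tabulate λ {i} _ k<i →
        ℕ.<⇒≱ (Fin.toℕ<n i) (≡.subst (ℕ._≤ toℕ i) k-last k<i))))

  interleave≈product : ∀ {q} (X Y : Fin q → M.Carrier) → (∀ k → suc (toℕ k) ≡ q → Y k M.≈ M.1#) →
                       interleave X Y M.≈ product (λ k → X k M.* Y k)
  interleave≈product {zero}        X Y Y-last = M.refl
  interleave≈product {suc zero}    X Y Y-last = M.sym
    (M.trans (M.*-identityʳ (X zero M.* Y zero))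
      (M.trans (M.*-congˡ {X zero} (Y-last zero ≡.refl)) (M.*-identityʳ (X zero))))
  interleave≈product {suc (suc q)} X Y Y-last =
    M.*-congˡ {X zero M.* Y zero} (interleave≈product (X ∘ suc) (Y ∘ suc) (λ k → Y-last (suc k) ∘ cong suc))

  -- On the left the coefficients are multiplied as series over the field before scaling; on the
  -- right each is a central scalar matrix, as the abstract expansion requires.
  ·-weight : ∀ gs Z → foldr (λ g → KS._*_ (coefficientOf g)) KS.1# gs · Z M.≈ weight M.semiring a gs M.* Z
  ·-weight []       Z = M.trans
    (λ I J → 𝓢.trans (𝓢.*-congʳ scalars-1#) (𝓢.*-identityˡ (Z I J))) (M.sym (M.*-identityˡ Z))
  ·-weight (g ∷ gs) Z = begin
    (coefficientOf g KS.* F) · Z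
      ≈⟨ (λ I J → 𝓢.trans (𝓢.*-congʳ (scalars-* (coefficientOf g) F))
           (𝓢.*-assoc (scalar ∘ coefficientOf g) (scalar ∘ F) (Z I J))) ⟩
    coefficientOf g · (F · Z)
      ≈⟨ (λ I J → 𝓢.*-congˡ {scalar ∘ coefficientOf g} (·-weight gs Z I J)) ⟩
    coefficientOf g · (weight M.semiring a gs M.* Z)
      ≈⟨ ∙1-* (seriesRing algebra) (scalar ∘ coefficientOf g) (weight M.semiring a gs M.* Z) ⟨
    a g M.* (weight M.semiring a gs M.* Z)
      ≈⟨ M.*-assoc (a g) (weight M.semiring a gs) Z ⟨
    weight M.semiring a (g ∷ gs) M.* Z ∎
    where
    open ≈-Reasoning M.setoid
    F = foldr (λ g → KS._*_ (coefficientOf g)) KS.1# gs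

  cycleWords : ∀ {σ : Permutation′ N} → CycleDecomposition σ → CycleWords σ
  cycleWords d = record { words = words ; disjoint = disjoint ; correct = correct }
    where open CycleDecomposition d

  ⟪B⟫-expansion : (cycles : (σ : Permutation′ N) → CycleDecomposition σ) →
    let open CycleDecomposition using (restrict≥) in
    ⟪B⟫ M.≈ ∑ (permutations N) (λ σ →
      ᾱ (cycles σ) · (operator (flip σ) M.* ∏ (λ i → slot (restrict≥ (cycles σ) i i) B[u- toℕ i ])))
  ⟪B⟫-expansion cycles = begin
    ⟪B⟫
      ≈⟨ interleave≈product (λ k → slot k B[u- toℕ k ]) Π Π-last ⟩
    product (λ k → slot k B[u- toℕ k ] M.* Π k)
      ≈⟨ product-cong M.semiring (λ k → M.*-congˡ {x = slot k B[u- toℕ k ]} (Π≈ k)) ⟩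
    product (fused a)
      -- On these words `nonMaximaOf` and `restrictFrom` unfold to `nonMaxima` and `restrict≥`, so
      -- only the form of the weight remains to be adjusted.
      ≈⟨ expansion M.semiring covariant a a-central (cycleWords ∘ cycles) ⟩
    listSum M.semiring (permutations N) (λ σ → weight M.semiring a (nonMaxima (cycles σ)) M.* Z σ)
      ≈⟨ listSum-cong M.semiring (permutations N) (λ σ → ·-weight (nonMaxima (cycles σ)) (Z σ)) ⟨
    ∑ (permutations N) (λ σ → ᾱ (cycles σ) · Z σ) ∎
    where
    open ≈-Reasoning M.setoid
    open CycleDecomposition using (restrict≥; nonMaxima)
    Z : Permutation′ N → M.Carrier
    Z σ = operator (flip σ) M.* ∏ (λ i → slot (restrict≥ (cycles σ) i i) B[u- toℕ i ])

open import Data.Nat.Base using (_+_)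

proposition5 :
  ∀ {c ℓ₁ ℓ₂} (K : HeytingField c ℓ₁ ℓ₂) (K₀ : CharacteristicZero K) (m l : ℕ)
    (cycles : (σ : Permutation′ (m + l)) → CycleDecomposition σ) →
  let open ReflectionAlgebra K K₀ m l
      open RawRing End using (_≈_)
      open RawRing End using (_*_)
      open CycleDecomposition using (restrict≥)
  in ⟪B⟫ ≈ ∑ (permutations (m + l)) (λ σ →
       ᾱ (cycles σ) · (operator (flip σ)
         * ∏ (λ i → slot (restrict≥ (cycles σ) i i) B[u- toℕ i ])))
proposition5 = Expansion.⟪B⟫-expansion
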